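{- Let $\mathcal{D}$ be a set of $n$ unit disks in the plane and let $G_{\mathcal{D}}=(V,E)$ be the intersection graph of $\mathcal{D}$. Then an induced bipartite subgraph of $G_{\mathcal{D}}$ with at least $|\mathrm{MBS}(G_{\mathcal{D}})|/\max(1,2\log n)$ vertices can be computed in $O(n\log n+|E|)$ time, where $\mathrm{MBS}(G_{\mathcal{D}})$ denotes a maximum induced bipartite subgraph of $G_{\mathcal{D}}$ and $|\mathrm{MBS}(G_{\mathcal{D}})|$ is its number of vertices.
   Context: Unit disks are closed disks of radius 1 in the plane. The intersection graph of $\mathcal{D}$ has one vertex per disk, two vertices being adjacent if and only if the corresponding disks intersect. Logarithms are to base 2. Running times count elementary operations, including arithmetic on real numbers, at unit cost. -}

module Defs where

open import Algebra.Bundles using (CommutativeRing)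
open import Algebra.Bundles.Raw using (RawRing)
import Algebra.Properties.CommutativeSemigroup as CommutativeSemigroupProperties
import Algebra.Properties.Ring as RingProperties
import Algebra.Solver.Ring as RingSolver
import Algebra.Solver.Ring.AlmostCommutativeRing as ACR
open import Algebra.Structures using (IsCommutativeRing)
open import Data.Bool.Base using (Bool; true; false; not; _∧_; if_then_else_)
open import Data.Fin.Base using (Fin; toℕ; fromℕ<)
import Data.Fin.Properties as Fin
open import Data.Fin.Subset using (Subset; _∈_; ∣_∣)
open import Data.List.Base using (List; length; filter; cartesianProduct; allFin)
open import Data.Maybe.Base using (Maybe; just; nothing)
open import Data.Nat.Base as ℕ using (ℕ; zero; suc; NonZero)
import Data.Nat.Properties as ℕ
open import Data.Product.Base using (∃; ∃₂; _×_; _,_; proj₁; proj₂)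
open import Data.Sum.Base using (inj₁; inj₂)
open import Data.Vec.Base using (tabulate)
open import Level using (0ℓ)
open import Relation.Binary.Bundles using (DecTotalOrder)
open import Relation.Binary.Core using (Rel)
open import Relation.Binary.Definitions using (Decidable)
open import Relation.Binary.PropositionalEquality as ≡ using (_≡_; _≢_; refl)
import Relation.Binary.Reasoning.Setoid as SetoidReasoning
open import Relation.Binary.Structures using (IsDecTotalOrder)
open import Relation.Nullary using (¬_; yes; no; contradiction)
open import Relation.Nullary.Decidable using (_×-dec_; ¬?; map′; ⌊_⌋)

------------------------------------------------------------------------
-- The real numbers, axiomatised as a Dedekind-complete ordered field.
-- This is the classical notion: completeness for arbitrary predicates
-- together with a decidable order entails weak excluded middle for Set.
-- Inversion is made total by the convention 0 ⁻¹ = 0.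

record Reals : Set₁ where
  infix  8 -_ _⁻¹
  infixl 7 _*_
  infixl 6 _+_
  infix  4 _≈_ _≤_
  field
    Carrier : Set
    _≈_ _≤_ : Rel Carrier 0ℓ
    _+_ _*_ : Carrier → Carrier → Carrier
    -_ _⁻¹  : Carrier → Carrier
    0# 1#   : Carrier

    isCommutativeRing : IsCommutativeRing _≈_ _+_ _*_ -_ 0# 1#
    isDecTotalOrder   : IsDecTotalOrder _≈_ _≤_

    0≉1         : ¬ 0# ≈ 1#
    ⁻¹-cong     : ∀ {x y} → x ≈ y → x ⁻¹ ≈ y ⁻¹
    ⁻¹-inverseʳ : ∀ {x} → ¬ x ≈ 0# → x * x ⁻¹ ≈ 1#
    0⁻¹≈0       : 0# ⁻¹ ≈ 0#

    +-monoˡ-≤ : ∀ z {x y} → x ≤ y → x + z ≤ y + z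
    *-nonNeg  : ∀ {x y} → 0# ≤ x → 0# ≤ y → 0# ≤ x * y

  UpperBound : (Carrier → Set) → Carrier → Set
  UpperBound P b = ∀ x → P x → x ≤ b

  field
    complete : ∀ (P : Carrier → Set) → ∃ P → ∃ (UpperBound P) →
               ∃ λ s → UpperBound P s × (∀ b → UpperBound P b → s ≤ b)

  commutativeRing : CommutativeRing 0ℓ 0ℓ
  commutativeRing = record { isCommutativeRing = isCommutativeRing }

  decTotalOrder : DecTotalOrder 0ℓ 0ℓ 0ℓ
  decTotalOrder = record { isDecTotalOrder = isDecTotalOrder }

  open CommutativeRing commutativeRing public
    using ( semiring; _-_; +-cong; +-congˡ; +-congʳ; *-cong; *-congˡ; *-congʳ
          ; +-comm; +-identityˡ; +-identityʳ; -‿inverseʳ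
          ; *-identityˡ; *-identityʳ; *-assoc )
    renaming (refl to ≈-refl; sym to ≈-sym; trans to ≈-trans)
  open DecTotalOrder decTotalOrder public
    using (_≟_; _≤?_; totalOrder; ≤-respʳ-≈; ≤-respˡ-≈)
    renaming ( refl to ≤-refl; trans to ≤-trans; reflexive to ≤-reflexive
             ; antisym to ≤-antisym; total to ≤-total )
  open import Algebra.Construct.NaturalChoice.Max totalOrder public
    using () renaming (_⊔_ to max)
  open import Algebra.Properties.Semiring.Mult semiring public
    using () renaming (_×_ to _·_; ×-homo-+ to ·-homo-+; ×1-homo-* to ·1-homo-*)

  infixl 7 _/_
  _/_ : Carrier → Carrier → Carrier
  x / y = x * y ⁻¹

  fromℕ : ℕ → Carrier
  fromℕ n = n · 1#

------------------------------------------------------------------------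
-- Ordered fields and the binary logarithm

module RealProperties (ℝ : Reals) where
  open Reals ℝ

  module Solver where
    open CommutativeRing commutativeRing
      using (ring; setoid; +-commutativeSemigroup; distribˡ; distribʳ; -‿cong; +-assoc; -‿inverseˡ)
    open RingProperties ring
      using (-‿+-comm; -‿involutive; -‿distribˡ-*; -‿distribʳ-*)
    open CommutativeSemigroupProperties +-commutativeSemigroup using (interchange)
    open SetoidReasoning setoid

    -- The pair (a , b) stands for the integer a − b. The solver compares
    -- normal forms up to conversion, so pairs are kept reduced.
    reduce : ℕ → ℕ → ℕ × ℕ
    reduce a b = a ℕ.∸ b , b ℕ.∸ a

    coefficients : RawRing 0ℓ 0ℓ
    coefficients = record
      { Carrier = ℕ × ℕ
      ; _≈_ = _≡_
      ; _+_ = λ (a , b) (c , d) → reduce (a ℕ.+ c) (b ℕ.+ d)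
      ; _*_ = λ (a , b) (c , d) → reduce (a ℕ.* c ℕ.+ b ℕ.* d) (a ℕ.* d ℕ.+ b ℕ.* c)
      ; -_  = λ (a , b) → b , a
      ; 0#  = 0 , 0
      ; 1#  = 1 , 0
      }

    ⟦_⟧ᶜ : ℕ × ℕ → Carrier
    ⟦ a , b ⟧ᶜ = fromℕ a - fromℕ b

    +-interchange : ∀ a b c d → (a + c) - (b + d) ≈ (a - b) + (c - d)
    +-interchange a b c d = ≈-trans (+-congˡ (≈-sym (-‿+-comm b d))) (interchange a c (- b) (- d))

    *-expand : ∀ a b c d → (a * c + b * d) - (a * d + b * c) ≈ (a - b) * (c - d)
    *-expand a b c d = begin
      (a * c + b * d) - (a * d + b * c)                 ≈⟨ +-interchange _ _ _ _ ⟩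
      (a * c - a * d) + (b * d - b * c)                 ≈⟨ +-cong (+-congˡ (-‿distribʳ-* a d)) swap ⟩
      (a * c + a * - d) + (- b * c + - b * - d)         ≈⟨ +-cong (distribˡ a c (- d)) (distribˡ (- b) c (- d)) ⟨
      a * (c - d) + - b * (c - d)                       ≈⟨ distribʳ (c - d) a (- b) ⟨
      (a - b) * (c - d)                                 ∎
      where
      swap : b * d - b * c ≈ - b * c + - b * - d
      swap = begin
        b * d - b * c           ≈⟨ +-comm _ _ ⟩
        - (b * c) + b * d       ≈⟨ +-cong (-‿distribˡ-* b c) (≈-sym (-‿involutive (b * d))) ⟩
        - b * c + - - (b * d)   ≈⟨ +-congˡ (-‿cong (-‿distribˡ-* b d)) ⟩
        - b * c + - (- b * d)   ≈⟨ +-congˡ (-‿distribʳ-* (- b) d) ⟩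
        - b * c + - b * - d     ∎

    neg-swap : ∀ a b → b - a ≈ - (a - b)
    neg-swap a b = begin
      b - a          ≈⟨ +-comm b (- a) ⟩
      - a + b        ≈⟨ +-congˡ (-‿involutive b) ⟨
      - a + - - b    ≈⟨ -‿+-comm a (- b) ⟩
      - (a - b)      ∎

    x-0≈x : ∀ x → x - 0# ≈ x
    x-0≈x x = begin
      x - 0#          ≈⟨ +-identityʳ (x - 0#) ⟨
      (x - 0#) + 0#   ≈⟨ +-assoc x (- 0#) 0# ⟩
      x + (- 0# + 0#) ≈⟨ +-congˡ (-‿inverseˡ 0#) ⟩
      x + 0#          ≈⟨ +-identityʳ x ⟩
      x               ∎

    shift : ∀ a b d → (a + d) - (b + d) ≈ a - b
    shift a b d = begin
      (a + d) - (b + d)    ≈⟨ +-interchange a b d d ⟩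
      (a - b) + (d - d)    ≈⟨ +-congˡ (-‿inverseʳ d) ⟩
      (a - b) + 0#         ≈⟨ +-identityʳ (a - b) ⟩
      a - b                ∎

    ⟦⟧ᶜ-cong : ∀ a b c d → a ℕ.+ d ≡ c ℕ.+ b → ⟦ a , b ⟧ᶜ ≈ ⟦ c , d ⟧ᶜ
    ⟦⟧ᶜ-cong a b c d a+d≡c+b = begin
      fromℕ a - fromℕ b                           ≈⟨ shift (fromℕ a) (fromℕ b) (fromℕ d) ⟨
      (fromℕ a + fromℕ d) - (fromℕ b + fromℕ d)   ≈⟨ +-cong a+d≈c+b (-‿cong (+-comm _ _)) ⟩
      (fromℕ c + fromℕ b) - (fromℕ d + fromℕ b)   ≈⟨ shift (fromℕ c) (fromℕ d) (fromℕ b) ⟩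
      fromℕ c - fromℕ d                           ∎
      where
      a+d≈c+b : fromℕ a + fromℕ d ≈ fromℕ c + fromℕ b
      a+d≈c+b = begin
        fromℕ a + fromℕ d   ≈⟨ ·-homo-+ 1# a d ⟨
        fromℕ (a ℕ.+ d)     ≡⟨ ≡.cong fromℕ a+d≡c+b ⟩
        fromℕ (c ℕ.+ b)     ≈⟨ ·-homo-+ 1# c b ⟩
        fromℕ c + fromℕ b   ∎

    ⟦reduce⟧ : ∀ a b → ⟦ reduce a b ⟧ᶜ ≈ ⟦ a , b ⟧ᶜ
    ⟦reduce⟧ a b = ⟦⟧ᶜ-cong (a ℕ.∸ b) (b ℕ.∸ a) a b (∸-balance a b)
      where
      ∸-balance : ∀ a b → (a ℕ.∸ b) ℕ.+ b ≡ a ℕ.+ (b ℕ.∸ a)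
      ∸-balance zero    zero    = refl
      ∸-balance zero    (suc b) = refl
      ∸-balance (suc a) zero    = refl
      ∸-balance (suc a) (suc b) = ≡.trans (ℕ.+-suc (a ℕ.∸ b) b) (≡.cong suc (∸-balance a b))

    morphism : coefficients ACR.-Raw-AlmostCommutative⟶ ACR.fromCommutativeRing commutativeRing
    morphism = record
      { ⟦_⟧    = ⟦_⟧ᶜ
      ; +-homo = λ (a , b) (c , d) → begin
          ⟦ reduce (a ℕ.+ c) (b ℕ.+ d) ⟧ᶜ
            ≈⟨ ⟦reduce⟧ (a ℕ.+ c) (b ℕ.+ d) ⟩
          fromℕ (a ℕ.+ c) - fromℕ (b ℕ.+ d)
            ≈⟨ +-cong (·-homo-+ 1# a c) (-‿cong (·-homo-+ 1# b d)) ⟩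
          (fromℕ a + fromℕ c) - (fromℕ b + fromℕ d)
            ≈⟨ +-interchange (fromℕ a) (fromℕ b) (fromℕ c) (fromℕ d) ⟩
          ⟦ a , b ⟧ᶜ + ⟦ c , d ⟧ᶜ
            ∎
      ; *-homo = λ (a , b) (c , d) → begin
          ⟦ reduce (a ℕ.* c ℕ.+ b ℕ.* d) (a ℕ.* d ℕ.+ b ℕ.* c) ⟧ᶜ
            ≈⟨ ⟦reduce⟧ (a ℕ.* c ℕ.+ b ℕ.* d) (a ℕ.* d ℕ.+ b ℕ.* c) ⟩
          fromℕ (a ℕ.* c ℕ.+ b ℕ.* d) - fromℕ (a ℕ.* d ℕ.+ b ℕ.* c)
            ≈⟨ +-cong (fromℕ-dot a c b d) (-‿cong (fromℕ-dot a d b c)) ⟩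
          (fromℕ a * fromℕ c + fromℕ b * fromℕ d) - (fromℕ a * fromℕ d + fromℕ b * fromℕ c)
            ≈⟨ *-expand (fromℕ a) (fromℕ b) (fromℕ c) (fromℕ d) ⟩
          ⟦ a , b ⟧ᶜ * ⟦ c , d ⟧ᶜ
            ∎
      ; -‿homo = λ (a , b) → neg-swap (fromℕ a) (fromℕ b)
      ; 0-homo = x-0≈x 0#
      ; 1-homo = ≈-trans (x-0≈x (1# + 0#)) (+-identityʳ 1#)
      }
      where
      fromℕ-dot : ∀ a c b d → fromℕ (a ℕ.* c ℕ.+ b ℕ.* d) ≈ fromℕ a * fromℕ c + fromℕ b * fromℕ d
      fromℕ-dot a c b d = ≈-trans (·-homo-+ 1# (a ℕ.* c) (b ℕ.* d))
        (+-cong (·1-homo-* a c) (·1-homo-* b d))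

    _≟ᶜ_ : (x y : ℕ × ℕ) → Maybe (⟦ x ⟧ᶜ ≈ ⟦ y ⟧ᶜ)
    (a , b) ≟ᶜ (c , d) with a ℕ.+ d ℕ.≟ c ℕ.+ b
    ... | no  _       = nothing
    ... | yes a+d≡c+b = just (⟦⟧ᶜ-cong a b c d a+d≡c+b)

    open RingSolver coefficients (ACR.fromCommutativeRing commutativeRing) morphism _≟ᶜ_ public
      using (solve; _:=_; _:+_; _:*_; :-_; _:-_)

  open Solver using (solve; _:=_; _:+_; _:*_; :-_; _:-_)

  nonNeg⇒≤ : ∀ {x y} → 0# ≤ y - x → x ≤ y
  nonNeg⇒≤ {x} {y} p = ≤-respˡ-≈ (+-identityˡ x)
    (≤-respʳ-≈ (solve 2 (λ a b → (b :- a) :+ a := b) ≈-refl x y) (+-monoˡ-≤ x p))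

  ≤⇒nonNeg : ∀ {x y} → x ≤ y → 0# ≤ y - x
  ≤⇒nonNeg {x} p = ≤-respˡ-≈ (-‿inverseʳ x) (+-monoˡ-≤ (- x) p)

  +-mono-≤ : ∀ {w x y z} → w ≤ x → y ≤ z → w + y ≤ x + z
  +-mono-≤ {w} {x} {y} {z} p q = ≤-trans (+-monoˡ-≤ y p)
    (≤-respˡ-≈ (+-comm y x) (≤-respʳ-≈ (+-comm z x) (+-monoˡ-≤ x q)))

  *-monoʳ-≤ : ∀ {x y z} → 0# ≤ z → x ≤ y → x * z ≤ y * z
  *-monoʳ-≤ {x} {y} {z} p q = nonNeg⇒≤ (≤-respʳ-≈
    (solve 3 (λ a b c → (b :- a) :* c := b :* c :- (a :* c)) ≈-refl x y z)
    (*-nonNeg (≤⇒nonNeg q) p))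

  square-nonNeg : ∀ x → 0# ≤ x * x
  square-nonNeg x with ≤-total 0# x
  ... | inj₁ p = *-nonNeg p p
  ... | inj₂ p = ≤-respʳ-≈ (solve 1 (λ a → :- a :* :- a := a :* a) ≈-refl x) (*-nonNeg q q)
    where
    q : 0# ≤ - x
    q = ≤-respʳ-≈ (+-identityˡ (- x)) (≤⇒nonNeg p)

  0≤1 : 0# ≤ 1#
  0≤1 = ≤-respʳ-≈ (*-identityˡ 1#) (square-nonNeg 1#)

  ⁻¹-nonNeg : ∀ {x} → 0# ≤ x → 0# ≤ x ⁻¹
  ⁻¹-nonNeg {x} p with x ≟ 0#
  ... | yes x≈0 = ≤-reflexive (≈-sym (≈-trans (⁻¹-cong x≈0) 0⁻¹≈0))
  ... | no  x≉0 = ≤-respʳ-≈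
    (≈-trans (≈-sym (*-assoc x (x ⁻¹) (x ⁻¹)))
      (≈-trans (*-congʳ (⁻¹-inverseʳ x≉0)) (*-identityˡ (x ⁻¹))))
    (*-nonNeg p (square-nonNeg (x ⁻¹)))

  fromℕ-nonNeg : ∀ n → 0# ≤ fromℕ n
  fromℕ-nonNeg zero    = ≤-refl
  fromℕ-nonNeg (suc n) = ≤-respˡ-≈ (+-identityˡ 0#) (+-mono-≤ 0≤1 (fromℕ-nonNeg n))

  fromℕ-mono-≤ : ∀ {m n} → m ℕ.≤ n → fromℕ m ≤ fromℕ n
  fromℕ-mono-≤ {n = n} ℕ.z≤n = fromℕ-nonNeg n
  fromℕ-mono-≤ (ℕ.s≤s m≤n)   = +-mono-≤ ≤-refl (fromℕ-mono-≤ m≤n)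

  1≤⇒≉0 : ∀ {x} → 1# ≤ x → ¬ x ≈ 0#
  1≤⇒≉0 p x≈0 = 0≉1 (≤-antisym 0≤1 (≤-respʳ-≈ x≈0 p))

  fromℕ-suc≉0 : ∀ n → ¬ fromℕ (suc n) ≈ 0#
  fromℕ-suc≉0 n = 1≤⇒≉0 (≤-respˡ-≈ (+-identityʳ 1#) (+-mono-≤ ≤-refl (fromℕ-nonNeg n)))

  /-cancelʳ : ∀ x {y} → ¬ y ≈ 0# → (x * y) / y ≈ x
  /-cancelʳ x {y} y≉0 = ≈-trans (*-assoc x y (y ⁻¹))
    (≈-trans (*-congˡ (⁻¹-inverseʳ y≉0)) (*-identityʳ x))

  -- The nonnegative rationals r with 2 ^ r ≤ n, written r = p / (q + 1); for
  -- n ≥ 1 their supremum is the logarithm of n.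
  BelowLog₂ : ℕ → Carrier → Set
  BelowLog₂ n x = ∃₂ λ p q → 2 ℕ.^ p ℕ.≤ n ℕ.^ suc q × x ≈ fromℕ p / fromℕ (suc q)

  private
    n≤2^n : ∀ n → n ℕ.≤ 2 ℕ.^ n
    n≤2^n zero    = ℕ.z≤n
    n≤2^n (suc n) = ℕ.≤-trans (ℕ.+-mono-≤ (ℕ.m^n>0 2 n) (n≤2^n n))
      (ℕ.+-monoʳ-≤ (2 ℕ.^ n) (ℕ.m≤m+n (2 ℕ.^ n) 0))

    exponent-bound : ∀ n p q → 2 ℕ.^ p ℕ.≤ n ℕ.^ q → p ℕ.≤ n ℕ.* q
    exponent-bound n p q 2^p≤n^q with p ℕ.≤? n ℕ.* q
    ... | yes p≤nq = p≤nq
    ... | no  p≰nq = contradiction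
      (ℕ.≤-trans 2^p≤n^q
        (ℕ.≤-trans (ℕ.^-monoˡ-≤ q (n≤2^n n)) (ℕ.≤-reflexive (ℕ.^-*-assoc 2 n q))))
      (ℕ.<⇒≱ (ℕ.^-monoʳ-< 2 (ℕ.s≤s (ℕ.s≤s ℕ.z≤n)) (ℕ.≰⇒> p≰nq)))

  belowLog₂-inhabited : ∀ n .{{_ : NonZero n}} → ∃ (BelowLog₂ n)
  belowLog₂-inhabited n = fromℕ 0 / fromℕ 1 , 0 , 0 , ℕ.m^n>0 n 1 , ≈-refl

  belowLog₂-bounded : ∀ n → ∃ (UpperBound (BelowLog₂ n))
  belowLog₂-bounded n = fromℕ n , bound
    where
    bound : UpperBound (BelowLog₂ n) (fromℕ n)
    bound x (p , q , le , x≈p/q) = ≤-respˡ-≈ (≈-sym x≈p/q) (≤-trans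
      (*-monoʳ-≤ (⁻¹-nonNeg (fromℕ-nonNeg (suc q)))
        (fromℕ-mono-≤ (exponent-bound n p (suc q) le)))
      (≤-reflexive (≈-trans (*-congʳ (·1-homo-* n (suc q)))
        (/-cancelʳ (fromℕ n) (fromℕ-suc≉0 q)))))

  log₂ : (n : ℕ) .{{_ : NonZero n}} → Carrier
  log₂ n = proj₁ (complete (BelowLog₂ n) (belowLog₂-inhabited n) (belowLog₂-bounded n))

------------------------------------------------------------------------
-- Simple graphs

record Graph (V : Set) : Set₁ where
  field
    Adj    : Rel V 0ℓ
    sym    : ∀ {u v} → Adj u v → Adj v u
    irrefl : ∀ {v} → ¬ Adj v v

open Graph public using (Adj)

infix 9 _[_]

_[_] : ∀ {n} → Graph (Fin n) → (S : Subset n) → Graph (∃ (_∈ S))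
G [ S ] = record
  { Adj    = λ u v → Adj G (proj₁ u) (proj₁ v)
  ; sym    = Graph.sym G
  ; irrefl = Graph.irrefl G
  }

Bipartite : {V : Set} → Graph V → Set
Bipartite {V} G = ∃ λ (colour : V → Bool) → ∀ {u v} → Adj G u v → colour u ≢ colour v

IsMBS : ∀ {n} → Graph (Fin n) → Subset n → Set
IsMBS G M = Bipartite (G [ M ]) × (∀ S → Bipartite (G [ S ]) → ∣ S ∣ ℕ.≤ ∣ M ∣)

-- Each edge is listed once, smaller endpoint first.
edges : ∀ {n} (G : Graph (Fin n)) → Decidable (Adj G) → List (Fin n × Fin n)
edges {n} G adj? = filter (λ (i , j) → i Fin.<? j ×-dec adj? i j)
                          (cartesianProduct (allFin n) (allFin n))

------------------------------------------------------------------------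
-- Unit disks and their intersection graph

module UnitDisks (ℝ : Reals) where
  open Reals ℝ
  open RealProperties ℝ

  open Solver using (solve; _:=_; _:+_; _:*_; :-_; _:-_)

  Point : Set
  Point = Carrier × Carrier

  infix 4 _≈ᴾ_ _∈ᴰ_ _≈ᴰ_

  _≈ᴾ_ : Rel Point 0ℓ
  (x , y) ≈ᴾ (x′ , y′) = x ≈ x′ × y ≈ y′

  dist² : Point → Point → Carrier
  dist² (x , y) (x′ , y′) = (x - x′) * (x - x′) + (y - y′) * (y - y′)

  record UnitDisk : Set where
    constructor disk
    field centre : Point

  open UnitDisk public

  _≈ᴰ_ : Rel UnitDisk 0ℓ
  A ≈ᴰ B = centre A ≈ᴾ centre B

  _∈ᴰ_ : Point → UnitDisk → Set
  p ∈ᴰ A = dist² p (centre A) ≤ 1#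

  Intersect : Rel UnitDisk 0ℓ
  Intersect A B = ∃ λ p → p ∈ᴰ A × p ∈ᴰ B

  intersectionGraph : ∀ {n} → (Fin n → UnitDisk) → Graph (Fin n)
  intersectionGraph D = record
    { Adj    = λ i j → i ≢ j × Intersect (D i) (D j)
    ; sym    = λ (i≢j , p , p∈i , p∈j) → (λ j≡i → i≢j (≡.sym j≡i)) , p , p∈j , p∈i
    ; irrefl = λ (i≢i , _) → i≢i refl
    }

  2# 4# ½ : Carrier
  2# = 1# + 1#
  4# = 2# + 2#
  ½  = 2# ⁻¹

  2½≈1 : 2# * ½ ≈ 1#
  2½≈1 = ⁻¹-inverseʳ (1≤⇒≉0 (≤-respˡ-≈ (+-identityˡ 1#) (+-mono-≤ 0≤1 ≤-refl)))

  ½+½≈1 : ½ + ½ ≈ 1#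
  ½+½≈1 = ≈-trans (≈-sym (+-cong (*-identityˡ ½) (*-identityˡ ½)))
    (≈-trans (solve 2 (λ o h → o :* h :+ o :* h := (o :+ o) :* h) ≈-refl 1# ½) 2½≈1)

  -- 2 |p − a|² + 2 |p − b|² = |a − b|² + |2 p − a − b|²
  intersect⇒near : ∀ A B → Intersect A B → dist² (centre A) (centre B) ≤ 4#
  intersect⇒near (disk (a , a′)) (disk (b , b′)) ((p , p′) , p∈A , p∈B) = ≤-trans
    (nonNeg⇒≤ (≤-respʳ-≈
      (solve 6 (λ a a′ b b′ p p′ →
          (((p :+ p) :- a) :- b) :* (((p :+ p) :- a) :- b)
            :+ (((p′ :+ p′) :- a′) :- b′) :* (((p′ :+ p′) :- a′) :- b′)
          := ((d p p′ a a′ :+ d p p′ b b′) :+ (d p p′ a a′ :+ d p p′ b b′)) :- d a a′ b b′)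
        ≈-refl a a′ b b′ p p′)
      (≤-respˡ-≈ (+-identityˡ 0#) (+-mono-≤ (square-nonNeg _) (square-nonNeg _)))))
    (+-mono-≤ (+-mono-≤ p∈A p∈B) (+-mono-≤ p∈A p∈B))
    where d = λ x x′ y y′ → (x :- y) :* (x :- y) :+ (x′ :- y′) :* (x′ :- y′)

  near⇒intersect : ∀ A B → dist² (centre A) (centre B) ≤ 4# → Intersect A B
  near⇒intersect (disk (a , a′)) (disk (b , b′)) near =
    (½ * (a + b) , ½ * (a′ + b′)) , ≤-respˡ-≈ (≈-sym eqˡ) near′ , ≤-respˡ-≈ (≈-sym eqʳ) near′
    where
    d² = dist² (a , a′) (b , b′)

    near′ : d² * (½ * ½) ≤ 1#
    near′ = ≤-trans (*-monoʳ-≤ (square-nonNeg ½) near) (≤-reflexive (≈-trans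
      (*-congʳ {½ * ½} {4#} {4#} ≈-refl)
      (≈-trans (solve 2 (λ o h → ((o :+ o) :+ (o :+ o)) :* (h :* h) := (o :* h :+ o :* h) :* (h :+ h)) ≈-refl 1# ½)
        (≈-trans (*-cong (≈-trans (+-cong (*-identityˡ ½) (*-identityˡ ½)) ½+½≈1) ½+½≈1)
          (*-identityˡ 1#)))))

    -- Along each axis, the midpoint is at half the difference.
    half : ∀ x y → ½ * (x + y) - x ≈ ½ * (y - x)
    half x y = ≈-trans
      (+-congˡ (≈-trans (≈-sym (*-identityˡ (- x))) (*-congʳ (≈-sym ½+½≈1))))
      (solve 3 (λ h x y → h :* (x :+ y) :+ (h :+ h) :* :- x := h :* (y :- x)) ≈-refl ½ x y)

    half′ : ∀ x y → ½ * (y + x) - x ≈ ½ * (y - x)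
    half′ x y = ≈-trans (+-congʳ (*-congˡ (+-comm y x))) (half x y)

    eqˡ : dist² (½ * (a + b) , ½ * (a′ + b′)) (a , a′) ≈ d² * (½ * ½)
    eqˡ = ≈-trans
      (+-cong (*-cong (half a b) (half a b)) (*-cong (half a′ b′) (half a′ b′)))
      (solve 5 (λ h a a′ b b′ →
          (h :* (b :- a)) :* (h :* (b :- a)) :+ (h :* (b′ :- a′)) :* (h :* (b′ :- a′))
          := ((a :- b) :* (a :- b) :+ (a′ :- b′) :* (a′ :- b′)) :* (h :* h))
        ≈-refl ½ a a′ b b′)

    eqʳ : dist² (½ * (a + b) , ½ * (a′ + b′)) (b , b′) ≈ d² * (½ * ½)
    eqʳ = ≈-trans
      (+-cong (*-cong (half′ b a) (half′ b a)) (*-cong (half′ b′ a′) (half′ b′ a′)))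
      (solve 5 (λ h a a′ b b′ →
          (h :* (a :- b)) :* (h :* (a :- b)) :+ (h :* (a′ :- b′)) :* (h :* (a′ :- b′))
          := ((a :- b) :* (a :- b) :+ (a′ :- b′) :* (a′ :- b′)) :* (h :* h))
        ≈-refl ½ a a′ b b′)

  intersect? : Decidable Intersect
  intersect? A B = map′ (near⇒intersect A B) (intersect⇒near A B)
    (dist² (centre A) (centre B) ≤? 4#)

  ∣E_∣ : ∀ {n} → (Fin n → UnitDisk) → ℕ
  ∣E D ∣ = length (edges (intersectionGraph D)
                         (λ i j → ¬? (i Fin.≟ j) ×-dec intersect? (D i) (D j)))

------------------------------------------------------------------------
-- The real RAM
--
-- A program uses finitely many arrays, named by numerals. Each is unbounded
-- and holds either naturals or exact reals. Naturals serve as indices and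
-- counters: their unit-cost operations are additive only, since unit-cost
-- multiplication of unbounded integers is unreasonably powerful. For the same
-- reason reals cannot be rounded or converted to naturals.

module RealRAM (ℝ : Reals) where
  open Reals ℝ

  infix  9 _⟨_⟩
  infixl 7 _⊗_ _⊘_
  infixl 6 _⊕_ _⊖_
  infix  5 _≤ⁿ_ _≤ʳ_
  infix  4 _⟨_⟩≔ⁿ_ _⟨_⟩≔ʳ_
  infixr 3 _⨟_

  data NatExp : Set where
    lit     : ℕ → NatExp
    _⟨_⟩    : (array : ℕ) (index : NatExp) → NatExp
    _⊕_ _⊖_ : (e f : NatExp) → NatExp

  data RealExp : Set where
    zeroʳ oneʳ      : RealExp
    _⟨_⟩            : (array : ℕ) (index : NatExp) → RealExp
    _⊕_ _⊖_ _⊗_ _⊘_ : (e f : RealExp) → RealExp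

  data Test : Set where
    _≤ⁿ_   : (e f : NatExp) → Test
    _≤ʳ_   : (e f : RealExp) → Test
    notᵗ   : Test → Test
    _andᵗ_ : (b c : Test) → Test

  data Program : Set where
    skip           : Program
    _⟨_⟩≔ⁿ_        : (array : ℕ) (index : NatExp) (e : NatExp) → Program
    _⟨_⟩≔ʳ_        : (array : ℕ) (index : NatExp) (e : RealExp) → Program
    _⨟_            : (P Q : Program) → Program
    ifᵗ_then_else_ : (b : Test) (P Q : Program) → Program
    while_loop_    : (b : Test) (P : Program) → Program

  record Memory : Set where
    constructor memory
    field
      nats  : ℕ → ℕ → ℕ
      reals : ℕ → ℕ → Carrier

  open Memory public

  update : {A : Set} → (ℕ → ℕ → A) → ℕ → ℕ → A → ℕ → ℕ → A
  update m a i v b j = if ⌊ a ℕ.≟ b ⌋ ∧ ⌊ i ℕ.≟ j ⌋ then v else m b j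

  evalⁿ : NatExp → Memory → ℕ
  evalⁿ (lit k)   m = k
  evalⁿ (a ⟨ i ⟩) m = nats m a (evalⁿ i m)
  evalⁿ (e ⊕ f)   m = evalⁿ e m ℕ.+ evalⁿ f m
  evalⁿ (e ⊖ f)   m = evalⁿ e m ℕ.∸ evalⁿ f m

  evalʳ : RealExp → Memory → Carrier
  evalʳ zeroʳ     m = 0#
  evalʳ oneʳ      m = 1#
  evalʳ (a ⟨ i ⟩) m = reals m a (evalⁿ i m)
  evalʳ (e ⊕ f)   m = evalʳ e m + evalʳ f m
  evalʳ (e ⊖ f)   m = evalʳ e m - evalʳ f m
  evalʳ (e ⊗ f)   m = evalʳ e m * evalʳ f m
  evalʳ (e ⊘ f)   m = evalʳ e m / evalʳ f m

  evalᵗ : Test → Memory → Bool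
  evalᵗ (e ≤ⁿ f)   m = ⌊ evalⁿ e m ℕ.≤? evalⁿ f m ⌋
  evalᵗ (e ≤ʳ f)   m = ⌊ evalʳ e m ≤? evalʳ f m ⌋
  evalᵗ (notᵗ b)   m = not (evalᵗ b m)
  evalᵗ (b andᵗ c) m = evalᵗ b m ∧ evalᵗ c m

  costⁿ : NatExp → ℕ
  costⁿ (lit k)   = 1
  costⁿ (a ⟨ i ⟩) = suc (costⁿ i)
  costⁿ (e ⊕ f)   = suc (costⁿ e ℕ.+ costⁿ f)
  costⁿ (e ⊖ f)   = suc (costⁿ e ℕ.+ costⁿ f)

  costʳ : RealExp → ℕ
  costʳ zeroʳ     = 1
  costʳ oneʳ      = 1
  costʳ (a ⟨ i ⟩) = suc (costⁿ i)
  costʳ (e ⊕ f)   = suc (costʳ e ℕ.+ costʳ f)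
  costʳ (e ⊖ f)   = suc (costʳ e ℕ.+ costʳ f)
  costʳ (e ⊗ f)   = suc (costʳ e ℕ.+ costʳ f)
  costʳ (e ⊘ f)   = suc (costʳ e ℕ.+ costʳ f)

  costᵗ : Test → ℕ
  costᵗ (e ≤ⁿ f)   = suc (costⁿ e ℕ.+ costⁿ f)
  costᵗ (e ≤ʳ f)   = suc (costʳ e ℕ.+ costʳ f)
  costᵗ (notᵗ b)   = suc (costᵗ b)
  costᵗ (b andᵗ c) = suc (costᵗ b ℕ.+ costᵗ c)

  infix 2 ⟨_,_⟩⇓⟨_,_⟩

  -- ⟨ P , m ⟩⇓⟨ m′ , t ⟩: started in m, P halts in m′ after t operations.
  data ⟨_,_⟩⇓⟨_,_⟩ : Program → Memory → Memory → ℕ → Set where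
    skip : ∀ {m} → ⟨ skip , m ⟩⇓⟨ m , 1 ⟩
    assignⁿ : ∀ {a i e m} →
      ⟨ a ⟨ i ⟩≔ⁿ e , m ⟩⇓⟨ memory (update (nats m) a (evalⁿ i m) (evalⁿ e m)) (reals m)
                          , suc (costⁿ i ℕ.+ costⁿ e) ⟩
    assignʳ : ∀ {a i e m} →
      ⟨ a ⟨ i ⟩≔ʳ e , m ⟩⇓⟨ memory (nats m) (update (reals m) a (evalⁿ i m) (evalʳ e m))
                          , suc (costⁿ i ℕ.+ costʳ e) ⟩
    seq : ∀ {P Q m m′ m″ t u} → ⟨ P , m ⟩⇓⟨ m′ , t ⟩ → ⟨ Q , m′ ⟩⇓⟨ m″ , u ⟩ →
      ⟨ P ⨟ Q , m ⟩⇓⟨ m″ , t ℕ.+ u ⟩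
    if-true : ∀ {b P Q m m′ t} → evalᵗ b m ≡ true → ⟨ P , m ⟩⇓⟨ m′ , t ⟩ →
      ⟨ ifᵗ b then P else Q , m ⟩⇓⟨ m′ , suc (costᵗ b ℕ.+ t) ⟩
    if-false : ∀ {b P Q m m′ t} → evalᵗ b m ≡ false → ⟨ Q , m ⟩⇓⟨ m′ , t ⟩ →
      ⟨ ifᵗ b then P else Q , m ⟩⇓⟨ m′ , suc (costᵗ b ℕ.+ t) ⟩
    while-true : ∀ {b P m m′ m″ t u} → evalᵗ b m ≡ true →
      ⟨ P , m ⟩⇓⟨ m′ , t ⟩ → ⟨ while b loop P , m′ ⟩⇓⟨ m″ , u ⟩ →
      ⟨ while b loop P , m ⟩⇓⟨ m″ , suc (costᵗ b ℕ.+ t ℕ.+ u) ⟩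
    while-false : ∀ {b P m} → evalᵗ b m ≡ false →
      ⟨ while b loop P , m ⟩⇓⟨ m , suc (costᵗ b) ⟩

  open UnitDisks ℝ

  -- Cell 0 of natural array 0 holds n; real arrays 0 and 1 hold the x- and
  -- y-coordinates of the n centres; every other cell holds zero.
  input : ∀ {n} → (Fin n → UnitDisk) → Memory
  input {n} D = memory initialⁿ initialʳ
    where
    initialⁿ : ℕ → ℕ → ℕ
    initialⁿ 0 0 = n
    initialⁿ _ _ = 0

    coordinate : (Point → Carrier) → ℕ → Carrier
    coordinate π i with i ℕ.<? n
    ... | yes i<n = π (centre (D (fromℕ< i<n)))
    ... | no  _   = 0#

    initialʳ : ℕ → ℕ → Carrier
    initialʳ 0 = coordinate proj₁
    initialʳ 1 = coordinate proj₂
    initialʳ _ = λ _ → 0#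

  -- The i-th disk is selected when cell i of natural array 1 holds 1.
  output : ∀ n → Memory → Subset n
  output n m = tabulate λ i → ⌊ nats m 1 (toℕ i) ℕ.≟ 1 ⌋

{-# OPTIONS --safe #-}

-- Up to 16 disks, any two of them will do, because n / 2 ≤ 2 log n. With more
-- disks, sort by abscissa and cut the plane greedily into vertical slabs of
-- width 2, each starting at the leftmost disk not yet covered; then scan the
-- disks by ordinate, selecting a disk if it lies more than 2 above the last
-- one selected in its slab. Selected disks of one slab are disjoint, and so
-- are disks whose slabs differ by at least 2, so the parity of the slab
-- colours the selection properly. Every disk lies in the 2 × 2 box on top of
-- a selected one. Each of the four unit cells of that box is a clique, hence
-- contains at most two disks of a bipartite subgraph, which bounds the ratio
-- by 8 ≤ 2 log n. Only the two merge sorts are not linear.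
module Submission where

open import Defs
open import Algebra.Bundles using (CommutativeRing)
import Algebra.Construct.NaturalChoice.Max as NaturalChoiceMax
open import Data.Bool.Base using (Bool; true; false)
open import Data.Fin.Base using (Fin; zero; suc; toℕ; fromℕ<; combine)
open import Data.Fin.Properties
  using (suc-injective; injective⇒≤; combine-injective; toℕ<n; toℕ-fromℕ<; fromℕ<-toℕ; toℕ-injective)
open import Data.Fin.Subset using (Subset; ∣_∣; _∈_; inside; outside)
open import Data.Nat.Base as ℕ using (ℕ; zero; suc; NonZero)
import Data.Nat.Properties as ℕ
open import Data.Product.Base using (∃; ∃₂; _×_; _,_; proj₁; proj₂)
open import Data.Sum.Base using (_⊎_; inj₁; inj₂; [_,_]′)
open import Data.Vec.Base using (_∷_; here; there)
open import Function.Definitions using (Injective)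
open import Relation.Binary.PropositionalEquality
  using (_≡_; _≢_; refl; sym; trans; cong; cong₂; subst; subst₂)
open import Relation.Nullary using (¬_; Dec; yes; no; contradiction)
open import Relation.Nullary.Decidable using (⌊_⌋)

-- The machine cannot round reals, so disks cannot be hashed into a fixed grid. Slabs opened on
-- demand replace grid columns and order comparisons replace rows; this is what sorting is for.
-- Closed disks touch at centre distance exactly 2. Hence slabs are closed and all separations are
-- strict, expressed as negated inequalities. `log₂ n` is a supremum of fractions, so each estimate
-- on it is reduced to a comparison of integer powers: `2 ^ n ≤ n ^ 4` for few disks,
-- `2 ^ 8 ≤ n ^ 2` for many. Both are equalities at `n = 16`, where the two regimes meet. The
-- optimum itself is never examined: every bipartite induced subgraph injects into pairs of a
-- selected disk and one of 8 labels. The cost of loop-free code depends on its text alone, so time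
-- bounds are built from constants and iteration counts.

-- Comparing cardinalities of subsets by charging

element : ∀ {n} (p : Subset n) → Fin ∣ p ∣ → ∃ (_∈ p)
element (outside ∷ p) k       = let i , i∈p = element p k in suc i , there i∈p
element (inside  ∷ p) zero    = zero , here
element (inside  ∷ p) (suc k) = let i , i∈p = element p k in suc i , there i∈p

element-injective : ∀ {n} (p : Subset n) {k l} → proj₁ (element p k) ≡ proj₁ (element p l) → k ≡ l
element-injective (outside ∷ p) eq = element-injective p (suc-injective eq)
element-injective (inside  ∷ p) {zero}  {zero}  eq = refl
element-injective (inside  ∷ p) {suc k} {suc l} eq = cong suc (element-injective p (suc-injective eq))

position : ∀ {n} {p : Subset n} {i} → i ∈ p → Fin ∣ p ∣
position {p = inside ∷ p} here         = zero
position {p = inside  ∷ p} (there i∈p) = suc (position i∈p)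
position {p = outside ∷ p} (there i∈p) = position i∈p

position-injective : ∀ {n} {p : Subset n} {i j} (i∈p : i ∈ p) (j∈p : j ∈ p) →
  position i∈p ≡ position j∈p → i ≡ j
position-injective {p = inside ∷ p}  here        here        eq = refl
position-injective {p = inside ∷ p}  (there i∈p) (there j∈p) eq =
  cong suc (position-injective i∈p j∈p (suc-injective eq))
position-injective {p = outside ∷ p} (there i∈p) (there j∈p) eq =
  cong suc (position-injective i∈p j∈p eq)

-- A charging argument: the pair (position of the owner, label) determines the element, so each
-- member of `O` is charged at most `k` times.
card-≤ : ∀ {n k} (M O : Subset n) (owner : ∃ (_∈ M) → ∃ (_∈ O)) (label : ∃ (_∈ M) → Fin k) →
  (∀ i j → proj₁ (owner i) ≡ proj₁ (owner j) → label i ≡ label j → proj₁ i ≡ proj₁ j) →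
  ∣ M ∣ ℕ.≤ ∣ O ∣ ℕ.* k
card-≤ M O owner label injective = injective⇒≤ {f = f} λ {a} {b} eq →
  let pos≡ , label≡ = combine-injective _ _ _ _ eq
  in element-injective M (injective (element M a) (element M b)
       (position-injective (proj₂ (owner (element M a))) (proj₂ (owner (element M b))) pos≡) label≡)
  where
  f : Fin ∣ M ∣ → Fin _
  f a = combine (position (proj₂ (owner (element M a)))) (label (element M a))

bit : Bool → Fin 2
bit false = zero
bit true  = suc zero

bit-injective : ∀ {a b} → bit a ≡ bit b → a ≡ b
bit-injective {false} {false} _ = refl
bit-injective {true}  {true}  _ = refl

-- Inequalities in the ordered field and estimates on the logarithm

module Field (ℝ : Reals) where
  open Reals ℝ
  open RealProperties ℝ
  open UnitDisks ℝ
  open Solver using (solve; _:=_; _:+_; _:*_; :-_; _:-_)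

  ≰⇒≥ : ∀ {x y} → ¬ x ≤ y → y ≤ x
  ≰⇒≥ {x} {y} x≰y = [ (λ x≤y → contradiction x≤y x≰y) , (λ y≤x → y≤x) ]′ (≤-total x y)

  -- The product of the two nonnegative slacks `y + 1# - x` and `x + 1# - y` equals `1 - (x - y)²`.
  close : ∀ {x y} → x ≤ y + 1# → y ≤ x + 1# → (x - y) * (x - y) ≤ 1#
  close {x} {y} x≤ y≤ = ≤-respʳ-≈ (*-identityˡ 1#) (nonNeg⇒≤ (≤-respʳ-≈
    (solve 3 (λ x y o → ((y :+ o) :- x) :* ((x :+ o) :- y) := o :* o :- ((x :- y) :* (x :- y))) ≈-refl x y 1#)
    (*-nonNeg (≤⇒nonNeg x≤) (≤⇒nonNeg y≤))))

  -- One axis of the argument that a unit cell is a clique: the Boolean test against the midpoint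
  -- `a + 1#` is the coordinate of the cell, and either half has length 1.
  same-half : ∀ {a x y} → a ≤ x × x ≤ a + 2# → a ≤ y × y ≤ a + 2# →
    ⌊ x ≤? a + 1# ⌋ ≡ ⌊ y ≤? a + 1# ⌋ → (x - y) * (x - y) ≤ 1#
  same-half {a} {x} {y} (a≤x , x≤) (a≤y , y≤) eq with x ≤? a + 1# | y ≤? a + 1#
  ... | yes x≤a+1 | yes y≤a+1 = close (≤-trans x≤a+1 (+-monoˡ-≤ 1# a≤y)) (≤-trans y≤a+1 (+-monoˡ-≤ 1# a≤x))
  ... | no  x≰a+1 | no  y≰a+1 = close (within x≤ (≰⇒≥ y≰a+1)) (within y≤ (≰⇒≥ x≰a+1))
    where
    within : ∀ {u v} → u ≤ a + 2# → a + 1# ≤ v → u ≤ v + 1#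
    within u≤ ≤v = ≤-trans u≤ (≤-trans
      (≤-reflexive (solve 2 (λ a o → a :+ (o :+ o) := (a :+ o) :+ o) ≈-refl a 1#)) (+-monoˡ-≤ 1# ≤v))

  -- The squared diagonal of a unit cell against the squared centre distance at which unit disks
  -- touch.
  1+1≤4 : 1# + 1# ≤ 4#
  1+1≤4 = ≤-respˡ-≈ (+-identityˡ 2#) (+-monoˡ-≤ 2# (≤-trans 0≤1 (≤-respˡ-≈ (+-identityʳ 1#) (+-mono-≤ ≤-refl 0≤1))))

  -- For e = y − x − 2 ≥ 0 the nonnegative terms below add up to − e.
  square≤4 : ∀ {x y} → (x - y) * (x - y) ≤ 4# → y ≤ x + 2#
  square≤4 {x} {y} sq with ≤-total y (x + 2#)
  ... | inj₁ y≤ = y≤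
  ... | inj₂ ≤y = nonNeg⇒≤ (≤-respʳ-≈ sum≈
    (≤-respˡ-≈ (+-identityˡ 0#) (+-mono-≤ (≤⇒nonNeg sq)
      (≤-respˡ-≈ (+-identityˡ 0#) (+-mono-≤ (square-nonNeg e)
        (≤-respˡ-≈ (+-identityˡ 0#) (+-mono-≤ e≥0
          (≤-respˡ-≈ (+-identityˡ 0#) (+-mono-≤ e≥0 e≥0)))))))))
    where
    e = y - (x + 2#)
    e≥0 = ≤⇒nonNeg ≤y
    4≈ : 4# ≈ 2# * 2#
    4≈ = ≈-trans (≈-sym (+-cong (*-identityˡ 2#) (*-identityˡ 2#)))
      (solve 2 (λ o t → o :* t :+ o :* t := (o :+ o) :* t) ≈-refl 1# 2#)
    1e = *-identityˡ e
    -- The solver is given `1#` as an indeterminate, so the identity is made homogeneous of degree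
    -- two: `4#` becomes `2# * 2#` and `e` becomes `1# * e`.
    sum≈ : (4# - (x - y) * (x - y)) + (e * e + (e + (e + e))) ≈ (x + 2#) - y
    sum≈ = ≈-trans
      (+-cong (+-congʳ 4≈) (+-congˡ (+-cong (≈-sym 1e) (+-cong (≈-sym 1e) (≈-sym 1e)))))
      (≈-trans
        (solve 3 (λ x y o → let t = o :+ o ; e = y :- (x :+ t) in
            (t :* t :- ((x :- y) :* (x :- y))) :+ (e :* e :+ (o :* e :+ (o :* e :+ o :* e)))
            := :- (o :* e))
          ≈-refl x y 1#)
        (≈-trans (neg 1e) (solve 3 (λ x y t → :- (y :- (x :+ t)) := (x :+ t) :- y) ≈-refl x y 2#)))
      where
      neg : ∀ {u v} → u ≈ v → - u ≈ - v
      neg = CommutativeRing.-‿cong commutativeRing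

  quotient-≤ : ∀ {x y z} → 1# ≤ z → x ≤ y * z → x / z ≤ y
  quotient-≤ {x} {y} {z} 1≤z x≤yz = ≤-trans
    (*-monoʳ-≤ (⁻¹-nonNeg (≤-trans 0≤1 1≤z)) x≤yz)
    (≤-reflexive (/-cancelʳ y (1≤⇒≉0 1≤z)))

  *-monoˡ-≤ : ∀ {x y z} → 0# ≤ z → x ≤ y → z * x ≤ z * y
  *-monoˡ-≤ {x} {y} {z} 0≤z x≤y = nonNeg⇒≤ (≤-respʳ-≈
    (solve 3 (λ x y z → (y :- x) :* z := z :* y :- (z :* x)) ≈-refl x y z) (*-nonNeg (≤⇒nonNeg x≤y) 0≤z))

  -- The fraction `p / suc q` belongs to the set whose supremum is `log₂ n`, so one comparison of
  -- integer powers certifies the bound. The denominator is cleared for later use.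
  log₂-≥ : ∀ n .{{_ : NonZero n}} p q → 2 ℕ.^ p ℕ.≤ n ℕ.^ suc q → fromℕ p ≤ fromℕ (suc q) * log₂ n
  log₂-≥ n p q 2^p≤n^q = ≤-trans (≤-reflexive (≈-sym p/q*q))
    (*-monoˡ-≤ (fromℕ-nonNeg (suc q)) (upper _ (p , q , 2^p≤n^q , ≈-refl)))
    where
    upper : UpperBound (BelowLog₂ n) (log₂ n)
    upper = proj₁ (proj₂ (complete (BelowLog₂ n) (belowLog₂-inhabited n) (belowLog₂-bounded n)))
    p/q*q : fromℕ (suc q) * (fromℕ p / fromℕ (suc q)) ≈ fromℕ p
    p/q*q = ≈-trans
      (solve 3 (λ p q q′ → q :* (p :* q′) := p :* q :* q′) ≈-refl (fromℕ p) (fromℕ (suc q)) (fromℕ (suc q) ⁻¹))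
      (/-cancelʳ (fromℕ p) (fromℕ-suc≉0 q))

  module _ (n : ℕ) .{{_ : NonZero n}} where

    ratio : Carrier
    ratio = max 1# ((1# + 1#) * log₂ n)

    open NaturalChoiceMax totalOrder using (x≤x⊔y; x≤y⊔x)

    1≤ratio : 1# ≤ ratio
    1≤ratio = x≤x⊔y 1# ((1# + 1#) * log₂ n)

    2log≤ratio : (1# + 1#) * log₂ n ≤ ratio
    2log≤ratio = x≤y⊔x 1# ((1# + 1#) * log₂ n)

    approximates : ∀ m o → fromℕ m ≤ fromℕ o * ratio → fromℕ m / ratio ≤ fromℕ o
    approximates m o = quotient-≤ 1≤ratio

    approximates-≤ : ∀ m o → m ℕ.≤ o → fromℕ m / ratio ≤ fromℕ o
    approximates-≤ m o m≤o = approximates m o (≤-trans (fromℕ-mono-≤ m≤o)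
      (≤-trans (≤-reflexive (≈-sym (*-identityʳ (fromℕ o)))) (*-monoˡ-≤ (fromℕ-nonNeg o) 1≤ratio)))

    -- The power inequality says that `p / suc q` is at most `2 log n`; the factor 2 sits in the
    -- exponent. Scaling by `k` serves both regimes: `k` is 1 when a fixed number of disks is
    -- output, and the size of the output when every selected disk is charged `p` times.
    approximates-log : ∀ m o k p q → 2 ℕ.^ p ℕ.≤ n ℕ.^ (2 ℕ.* suc q) → m ℕ.≤ k ℕ.* p → k ℕ.* suc q ℕ.≤ o →
      fromℕ m / ratio ≤ fromℕ o
    approximates-log m o k p q 2^p≤ m≤ ≤o = approximates m o (≤-trans (fromℕ-mono-≤ m≤)
      (≤-trans (≤-reflexive (·1-homo-* k p))
      -- The successor of `q ℕ.+ 1 ℕ.* suc q` is `2 ℕ.* suc q` by computation.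
      (≤-trans (*-monoˡ-≤ (fromℕ-nonNeg k) (log₂-≥ n p (q ℕ.+ 1 ℕ.* suc q) 2^p≤))
      (≤-trans (≤-reflexive regroup)
      (≤-trans (*-monoʳ-≤ 0≤2log (fromℕ-mono-≤ ≤o))
      (*-monoˡ-≤ (fromℕ-nonNeg o) 2log≤ratio))))))
      where
      0≤log : 0# ≤ log₂ n
      0≤log = proj₁ (proj₂ (complete (BelowLog₂ n) (belowLog₂-inhabited n) (belowLog₂-bounded n)))
        0# (0 , 0 , ℕ.m^n>0 n 1 , ≈-sym 0/1≈0)
        where
        0/1≈0 : fromℕ 0 / fromℕ 1 ≈ 0#
        0/1≈0 = CommutativeRing.zeroˡ commutativeRing _
      0≤2log : 0# ≤ (1# + 1#) * log₂ n
      0≤2log = *-nonNeg (≤-respˡ-≈ (+-identityˡ 0#) (+-mono-≤ 0≤1 0≤1)) 0≤log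
      regroup : fromℕ k * (fromℕ (2 ℕ.* suc q) * log₂ n) ≈ fromℕ (k ℕ.* suc q) * ((1# + 1#) * log₂ n)
      regroup = ≈-trans (*-congˡ (*-congʳ (≈-trans (·1-homo-* 2 (suc q)) (*-congʳ (+-congˡ (+-identityʳ 1#))))))
        (≈-trans
          (solve 4 (λ k t s l → k :* ((t :* s) :* l) := k :* s :* (t :* l)) ≈-refl
            (fromℕ k) (1# + 1#) (fromℕ (suc q)) (log₂ n))
          (*-congʳ (≈-sym (·1-homo-* k (suc q)))))

module Algorithm where
  open import Data.Bool.Base using (not)
  open import Data.Bool.Properties using (not-¬)
  open import Data.Empty using (⊥)
  import Data.Fin.Properties as Fin
  open import Data.Fin.Subset.Properties using (∣p∣≤n)
  open import Data.Nat.Base using (_+_; _*_; _∸_; _^_; _⊓_; _≤_; _<_; z≤n; s≤s; >-nonZero⁻¹)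
  open import Data.Nat.Properties
  open import Data.Unit.Base using (tt)
  open import Data.Vec.Properties using ([]=⇒lookup; lookup⇒[]=; lookup∘tabulate)
  open import Level using (0ℓ)
  open import Relation.Binary.Core using (Rel)
  open import Relation.Binary.Definitions using (tri<; tri≈; tri>)
  open import Relation.Nullary using (Reflects; ofʸ; ofⁿ)
  open import Relation.Nullary.Decidable using (isYes≗does; dec-true; dec-false; toWitness; _→-dec_)
  open import Relation.Nullary.Reflects using (¬-reflects; _×-reflects_)

  -- Merging sorted blocks

  -- An onto self-map of a finite set is a bijection, so the two fields determine a permutation of
  -- the numbers below `n`.
  record Permutation (n : ℕ) (A : ℕ → ℕ) : Set where
    field
      bounded : ∀ {k} → k < n → A k < n
      onto    : ∀ {i} → i < n → ∃ λ k → k < n × A k ≡ i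

  module Merging (_≼_ : Rel ℕ 0ℓ)
                 (≼-refl : ∀ {i} → i ≼ i)
                 (≼-trans : ∀ {i j k} → i ≼ j → j ≼ k → i ≼ k)
                 (n : ℕ) where

    SortedOn : (ℕ → ℕ) → ℕ → ℕ → Set
    SortedOn A lo hi = ∀ {i j} → lo ≤ i → i ≤ j → j < hi → A i ≼ A j

    -- The cutoff `k` lets the same predicate describe an array of which only the first `k` entries
    -- have been written.
    Blocks : ℕ → (ℕ → ℕ) → ℕ → Set
    Blocks w A k = ∀ t {i j} → t * w ≤ i → i ≤ j → j < t * w + w → j < k → A i ≼ A j

    module Pass (w : ℕ) (A : ℕ → ℕ) where

      W : ℕ
      W = w + w

      Pending : (p pe q qe : ℕ) → ℕ → Set
      Pending p pe q qe l = (p ≤ l × l < pe) ⊎ (q ≤ l × l < qe)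

      -- While two neighbouring blocks of A are merged into B, the entries
      -- [p , pe) and [q , qe) remain to be copied and the next one goes to
      -- position k. The number of merges begun is t, so that the current one
      -- fills the positions from t * W − W up to t * W ⊓ n.
      record State (k p pe q qe : ℕ) (B : ℕ → ℕ) : Set where
        field
          t       : ℕ
          qe≡     : qe ≡ t * W ⊓ n
          begun   : t * W ≤ k + W
          p≤pe    : p ≤ pe
          pe≤q    : pe ≤ q
          q≤qe    : q ≤ qe
          -- Rearranged, `(pe - p) + (qe - q) = qe - k`: the pending entries exactly fill the
          -- positions left before `qe`.
          balance : k + pe ≡ p + q
          sortedˡ : SortedOn A p pe
          sortedʳ : SortedOn A q qe
          -- The premise `t * W ≤ i + W` restricts `i` to the block being filled.
          below   : ∀ {i l} → i < k → t * W ≤ i + W → Pending p pe q qe l → B i ≼ A l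
          blocks  : Blocks W B k
          -- The alternative `q ≤ l` has no upper limit: it includes the blocks that no merge has
          -- reached yet.
          copied  : ∀ {l} → l < n → ((p ≤ l × l < pe) ⊎ q ≤ l) ⊎ ∃ λ i → i < k × B i ≡ A l
          origin  : ∀ {i} → i < k → ∃ λ l → l < n × B i ≡ A l

        qe≤n : qe ≤ n
        qe≤n = ≤-trans (≤-reflexive qe≡) (m⊓n≤n (t * W) n)

        pending<n : ∀ {l} → Pending p pe q qe l → l < n
        pending<n (inj₁ (_ , l<pe)) = <-≤-trans l<pe (≤-trans pe≤q (≤-trans q≤qe qe≤n))
        pending<n (inj₂ (_ , l<qe)) = <-≤-trans l<qe qe≤n

        -- Since `p ≤ pe`, `balance` gives `k ≤ q`, and `q ≤ qe ≤ k` closes the circle. The single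
        -- comparison `qe ≤ k` thus detects the end of a merge.
        exhausted : qe ≤ k → p ≡ pe × q ≡ k × qe ≡ k
        exhausted qe≤k = p≡pe , q≡k , ≤-antisym qe≤k (≤-trans (≤-reflexive (sym q≡k)) q≤qe)
          where
          k≤q : k ≤ q
          k≤q = +-cancelʳ-≤ pe k q (≤-trans (≤-reflexive balance)
            (≤-trans (+-monoˡ-≤ q p≤pe) (≤-reflexive (+-comm pe q))))
          q≡k : q ≡ k
          q≡k = ≤-antisym (≤-trans q≤qe qe≤k) k≤q
          p≡pe : p ≡ pe
          p≡pe = sym (+-cancelˡ-≡ k pe p (trans balance (trans (cong (p +_) q≡k) (+-comm p k))))

      open State

      -- With all scalars zero the state looks like a finished merge, so the first iteration opens
      -- the first pair of blocks by the general rule.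
      start : ∀ {B} → State 0 0 0 0 0 B
      start = record
        { t = 0 ; qe≡ = refl ; begun = z≤n ; p≤pe = z≤n ; pe≤q = z≤n ; q≤qe = z≤n ; balance = refl
        ; sortedˡ = λ _ _ () ; sortedʳ = λ _ _ () ; below = λ () ; blocks = λ _ _ _ _ ()
        ; copied = λ _ → inj₁ (inj₂ z≤n) ; origin = λ () }

      -- As `k < n`, the clipped end `t * W ⊓ n` of the finished merge can equal `k` only if `t * W`
      -- does, so the next pair consists of blocks `2t` and `2t + 1` of `A`. Clipping both new ends
      -- to `n` covers a short or missing last block.
      advance : ∀ {k p pe q qe B} → 0 < w → Blocks w A n → k < n → qe ≤ k → State k p pe q qe B →
        let pe′ = (k + w) ⊓ n ; qe′ = (k + W) ⊓ n in
        k < qe′ × State k k pe′ pe′ qe′ B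
      advance {k} {p} {pe} {q} {qe} {B} 0<w sorted k<n qe≤k s = k<qe′ , record
        { t = suc (t s)
        ; qe≡ = cong (_⊓ n) (sym end≡)
        ; begun = ≤-reflexive end≡
        ; p≤pe = ⊓-glb (m≤m+n k w) (<⇒≤ k<n)
        ; pe≤q = ≤-refl
        ; q≤qe = ⊓-monoˡ-≤ n (+-monoʳ-≤ k (m≤m+n w w))
        ; balance = refl
        ; sortedˡ = λ {i} k≤i i≤j j<pe → sorted (t s + t s)
            (≤-trans (≤-reflexive start≡) k≤i) i≤j
            (<-≤-trans j<pe (≤-trans (m⊓n≤m (k + w) n) (≤-reflexive (cong (_+ w) (sym start≡)))))
            (<-≤-trans j<pe (m⊓n≤n (k + w) n))
        ; sortedʳ = λ {i} {j} pe≤i i≤j j<qe →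
            let j<n = <-≤-trans j<qe (m⊓n≤n (k + W) n) in
            sorted (suc (t s + t s))
              (≤-trans (≤-reflexive (trans (+-comm w _) (cong (_+ w) start≡))) (beyond (≤-<-trans i≤j j<n) pe≤i))
              i≤j
              (<-≤-trans j<qe (≤-trans (m⊓n≤m (k + W) n) (≤-reflexive end′≡)))
              j<n
        -- The new output block is still empty: no position before `k` lies in it.
        ; below = λ {i} i<k far → contradiction
            (+-cancelʳ-≤ W k i (≤-trans (≤-reflexive (sym end≡)) far)) (<⇒≱ i<k)
        ; blocks = blocks s
        ; copied = λ l<n → [ remaining , inj₂ ]′ (copied s l<n)
        ; origin = origin s }
        where
        pe′ = (k + w) ⊓ n
        p≡pe = proj₁ (exhausted s qe≤k)
        q≡k = proj₁ (proj₂ (exhausted s qe≤k))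
        qe≡k = proj₂ (proj₂ (exhausted s qe≤k))

        tW≡k : t s * W ≡ k
        tW≡k with ≤-total (t s * W) n
        ... | inj₁ tW≤n = trans (sym (m≤n⇒m⊓n≡m tW≤n)) (trans (sym (qe≡ s)) qe≡k)
        ... | inj₂ n≤tW = contradiction
          (trans (sym qe≡k) (trans (qe≡ s) (m≥n⇒m⊓n≡n n≤tW))) (<⇒≢ k<n)

        end≡ : suc (t s) * W ≡ k + W
        end≡ = trans (+-comm W _) (cong (_+ W) tW≡k)

        start≡ : (t s + t s) * w ≡ k
        start≡ = trans (*-distribʳ-+ w (t s) (t s)) (trans (sym (*-distribˡ-+ (t s) w w)) tW≡k)

        end′≡ : k + W ≡ suc (t s + t s) * w + w
        end′≡ = trans (sym (+-assoc k w w))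
          (cong (_+ w) (trans (+-comm k w) (cong (w +_) (sym start≡))))

        beyond : ∀ {i} → i < n → pe′ ≤ i → k + w ≤ i
        beyond {i} i<n pe≤i with ≤-total (k + w) n
        ... | inj₁ le = ≤-trans (≤-reflexive (sym (m≤n⇒m⊓n≡m le))) pe≤i
        ... | inj₂ ge = contradiction (≤-trans (≤-reflexive (sym (m≥n⇒m⊓n≡n ge))) pe≤i) (<⇒≱ i<n)

        k<qe′ : k < (k + W) ⊓ n
        k<qe′ = ⊓-glb (≤-trans (≤-reflexive (sym (+-comm k 1))) (+-monoʳ-≤ k (≤-trans 0<w (m≤m+n w w)))) k<n

        remaining : ∀ {l} → (p ≤ l × l < pe) ⊎ q ≤ l →
          ((k ≤ l × l < pe′) ⊎ pe′ ≤ l) ⊎ ∃ λ i → i < k × B i ≡ A l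
        remaining (inj₁ (p≤l , l<pe)) =
          contradiction (≤-trans (≤-reflexive (sym p≡pe)) p≤l) (<⇒≱ l<pe)
        remaining {l} (inj₂ q≤l) with l <? pe′
        ... | yes l<pe′ = inj₁ (inj₁ (≤-trans (≤-reflexive (sym q≡k)) q≤l , l<pe′))
        ... | no  l≮pe′ = inj₁ (inj₂ (≮⇒≥ l≮pe′))

      -- The part of a copying step that both sides share; `x` is the index copied and `p′`, `q′`
      -- are the advanced cursors. By `below` the new entry comes after everything in its output
      -- block, and by minimality before everything still pending.
      emit : ∀ {k p pe q qe B B′ p′ q′ x} → k < qe → State k p pe q qe B →
        Pending p pe q qe x → (∀ {l} → Pending p pe q qe l → A x ≼ A l) →
        p ≤ p′ → p′ ≤ pe → q ≤ q′ → q′ ≤ qe → suc k + pe ≡ p′ + q′ →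
        (∀ {l} → (p ≤ l × l < pe) ⊎ q ≤ l → ((p′ ≤ l × l < pe) ⊎ q′ ≤ l) ⊎ x ≡ l) →
        B′ k ≡ A x → (∀ {i} → i ≢ k → B′ i ≡ B i) →
        State (suc k) p′ pe q′ qe B′
      emit {k} {p} {pe} {q} {qe} {B} {B′} {p′} {q′} {x}
           k<qe s x-pending x-least p≤p′ p′≤pe q≤q′ q′≤qe balance′ remaining B′k B′i = record
        { t = t s
        ; qe≡ = qe≡ s
        ; begun = ≤-trans (begun s) (n≤1+n _)
        ; p≤pe = p′≤pe
        ; pe≤q = ≤-trans (pe≤q s) q≤q′
        ; q≤qe = q′≤qe
        ; balance = balance′
        ; sortedˡ = λ p′≤i → sortedˡ s (≤-trans p≤p′ p′≤i)
        ; sortedʳ = λ q′≤i → sortedʳ s (≤-trans q≤q′ q′≤i)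
        ; below = below′
        ; blocks = blocks′
        ; copied = copied′
        ; origin = origin′ }
        where
        pending′ : ∀ {l} → Pending p′ pe q′ qe l → Pending p pe q qe l
        pending′ (inj₁ (p′≤l , l<pe)) = inj₁ (≤-trans p≤p′ p′≤l , l<pe)
        pending′ (inj₂ (q′≤l , l<qe)) = inj₂ (≤-trans q≤q′ q′≤l , l<qe)

        old : ∀ {i} → i < k → B′ i ≡ B i
        old i<k = B′i (<⇒≢ i<k)

        below′ : ∀ {i l} → i < suc k → t s * W ≤ i + W → Pending p′ pe q′ qe l → B′ i ≼ A l
        below′ {i} {l} i≤k begun′ pending with m<1+n⇒m<n∨m≡n i≤k
        ... | inj₁ i<k  = subst (_≼ A l) (sym (old i<k)) (below s i<k begun′ (pending′ pending))
        ... | inj₂ refl = subst (_≼ A l) (sym B′k) (x-least (pending′ pending))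

        -- A block containing k is the current one, as t * W − W ≤ k < t * W.
        current : ∀ t′ {i} → t′ * W ≤ i → k < t′ * W + W → t s * W ≤ i + W
        current t′ {i} t′W≤i k<t′W+W with t s ≤? suc t′
        ... | yes t≤t′ = ≤-trans (*-monoˡ-≤ W t≤t′) (≤-trans (≤-reflexive (+-comm W _)) (+-monoˡ-≤ W t′W≤i))
        ... | no  t≰t′ = contradiction (+-cancelʳ-≤ W _ _
          (≤-trans (≤-reflexive (trans (+-comm _ W) (cong (W +_) (+-comm _ W))))
            (≤-trans (*-monoˡ-≤ W (≰⇒> t≰t′)) (begun s)))) (<⇒≱ k<t′W+W)

        blocks′ : Blocks W B′ (suc k)
        blocks′ t′ {i} {j} t′W≤i i≤j j<end j≤k with m<1+n⇒m<n∨m≡n j≤k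
        ... | inj₁ j<k = subst₂ _≼_ (sym (old (≤-<-trans i≤j j<k))) (sym (old j<k))
                           (blocks s t′ t′W≤i i≤j j<end j<k)
        ... | inj₂ refl with m≤n⇒m<n∨m≡n i≤j
        ...   | inj₁ i<k  = subst₂ _≼_ (sym (old i<k)) (sym B′k)
                              (below s i<k (current t′ t′W≤i j<end) x-pending)
        ...   | inj₂ refl = ≼-refl

        copied′ : ∀ {l} → l < n → ((p′ ≤ l × l < pe) ⊎ q′ ≤ l) ⊎ ∃ λ i → i < suc k × B′ i ≡ A l
        copied′ l<n with copied s l<n
        ... | inj₂ (i , i<k , eq) = inj₂ (i , m<n⇒m<1+n i<k , trans (old i<k) eq)
        ... | inj₁ rest with remaining rest
        ...   | inj₁ rest′ = inj₁ rest′
        ...   | inj₂ refl  = inj₂ (k , n<1+n k , B′k)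

        origin′ : ∀ {i} → i < suc k → ∃ λ l → l < n × B′ i ≡ A l
        origin′ i≤k with m<1+n⇒m<n∨m≡n i≤k
        ... | inj₂ refl = x , pending<n s x-pending , B′k
        ... | inj₁ i<k  = let l , l<n , eq = origin s i<k in l , l<n , trans (old i<k) eq

      emitˡ : ∀ {k p pe q qe B B′} → k < qe → p < pe → (q < qe → A p ≼ A q) →
        B′ k ≡ A p → (∀ {i} → i ≢ k → B′ i ≡ B i) →
        State k p pe q qe B → State (suc k) (suc p) pe q qe B′
      emitˡ {p = p} {pe} {q} {qe} k<qe p<pe p≼q B′k B′i s =
        emit k<qe s (inj₁ (≤-refl , p<pe)) least (n≤1+n _) p<pe ≤-refl (q≤qe s)
          (cong suc (balance s)) rest B′k B′i
        where
        least : ∀ {l} → Pending p pe q qe l → A p ≼ A l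
        least (inj₁ (p≤l , l<pe)) = sortedˡ s ≤-refl p≤l l<pe
        least (inj₂ (q≤l , l<qe)) = ≼-trans (p≼q (≤-<-trans q≤l l<qe)) (sortedʳ s ≤-refl q≤l l<qe)

        rest : ∀ {l} → (p ≤ l × l < pe) ⊎ q ≤ l → ((suc p ≤ l × l < pe) ⊎ q ≤ l) ⊎ p ≡ l
        rest (inj₂ q≤l) = inj₁ (inj₂ q≤l)
        rest (inj₁ (p≤l , l<pe)) = [ (λ p<l → inj₁ (inj₁ (p<l , l<pe))) , inj₂ ]′ (m≤n⇒m<n∨m≡n p≤l)

      emitʳ : ∀ {k p pe q qe B B′} → k < qe → (p < pe → q < qe × A q ≼ A p) →
        B′ k ≡ A q → (∀ {i} → i ≢ k → B′ i ≡ B i) →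
        State k p pe q qe B → State (suc k) p pe (suc q) qe B′
      emitʳ {k} {p} {pe} {q} {qe} k<qe q≼p B′k B′i s =
        emit k<qe s (inj₂ (≤-refl , q<qe)) least ≤-refl (p≤pe s) (n≤1+n _) q<qe
          (trans (cong suc (balance s)) (sym (+-suc p q))) rest B′k B′i
        where
        -- When the left block is used up, `balance` gives `q = k`, which is below `qe`.
        q<qe : q < qe
        q<qe with m≤n⇒m<n∨m≡n (p≤pe s)
        ... | inj₁ p<pe = proj₁ (q≼p p<pe)
        ... | inj₂ refl = subst (_< qe) (+-cancelʳ-≡ p k q (trans (balance s) (+-comm p q))) k<qe

        least : ∀ {l} → Pending p pe q qe l → A q ≼ A l
        least (inj₁ (p≤l , l<pe)) = ≼-trans (proj₂ (q≼p (≤-<-trans p≤l l<pe))) (sortedˡ s ≤-refl p≤l l<pe)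
        least (inj₂ (q≤l , l<qe)) = sortedʳ s ≤-refl q≤l l<qe

        rest : ∀ {l} → (p ≤ l × l < pe) ⊎ q ≤ l → ((p ≤ l × l < pe) ⊎ suc q ≤ l) ⊎ q ≡ l
        rest (inj₁ pending) = inj₁ (inj₁ pending)
        rest (inj₂ q≤l) = [ (λ q<l → inj₁ (inj₂ q<l)) , inj₂ ]′ (m≤n⇒m<n∨m≡n q≤l)

      finish : ∀ {p pe q qe B} → Permutation n A → State n p pe q qe B → Blocks W B n × Permutation n B
      finish {p} {pe} {q} {qe} {B} perm s = blocks s , record { bounded = bounded′ ; onto = onto′ }
        where
        open Permutation perm
        bounded′ : ∀ {k} → k < n → B k < n
        bounded′ k<n = let l , l<n , eq = origin s k<n in subst (_< n) (sym eq) (bounded l<n)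

        done : ∀ {l} → l < n → ¬ ((p ≤ l × l < pe) ⊎ q ≤ l)
        done _ (inj₁ (p≤l , l<pe)) = <⇒≱ l<pe (≤-trans (≤-reflexive (sym (proj₁ (exhausted s (qe≤n s))))) p≤l)
        done l<n (inj₂ q≤l) = <⇒≱ l<n (≤-trans (≤-reflexive (sym (proj₁ (proj₂ (exhausted s (qe≤n s)))))) q≤l)

        onto′ : ∀ {i} → i < n → ∃ λ k → k < n × B k ≡ i
        onto′ i<n with onto i<n
        ... | l , l<n , refl = [ (λ rest → contradiction rest (done l<n)) , (λ c → c) ]′ (copied s l<n)

  -- A program logic for the real RAM

  module ProgramLogic (ℝ : Reals) where
    open Reals ℝ using () renaming (_≤_ to _≤ᴿ_; _≤?_ to _≤ᴿ?_)
    open RealRAM ℝ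

    isYes-reflects : ∀ {P : Set} (P? : Dec P) → Reflects P ⌊ P? ⌋
    isYes-reflects (yes p) = ofʸ p
    isYes-reflects (no ¬p) = ofⁿ ¬p

    Holds : Test → Memory → Set
    Holds (e ≤ⁿ f)   m = evalⁿ e m ≤ evalⁿ f m
    Holds (e ≤ʳ f)   m = evalʳ e m ≤ᴿ evalʳ f m
    Holds (notᵗ b)   m = ¬ Holds b m
    Holds (b andᵗ c) m = Holds b m × Holds c m

    reflects : ∀ b m → Reflects (Holds b m) (evalᵗ b m)
    reflects (e ≤ⁿ f)   m = isYes-reflects (evalⁿ e m ≤? evalⁿ f m)
    reflects (e ≤ʳ f)   m = isYes-reflects (evalʳ e m ≤ᴿ? evalʳ f m)
    reflects (notᵗ b)   m = ¬-reflects (reflects b m)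
    reflects (b andᵗ c) m = reflects b m ×-reflects reflects c m

    -- Preconditions are computed for loop-free code only. The value `⊥` on a loop sends all
    -- reasoning about loops to `runs-while`.
    wp : Program → (Memory → Set) → Memory → Set
    wp skip                      Q m = Q m
    wp (a ⟨ i ⟩≔ⁿ e)             Q m = Q (memory (update (nats m) a (evalⁿ i m) (evalⁿ e m)) (reals m))
    wp (a ⟨ i ⟩≔ʳ e)             Q m = Q (memory (nats m) (update (reals m) a (evalⁿ i m) (evalʳ e m)))
    wp (P ⨟ P′)                  Q m = wp P (wp P′ Q) m
    wp (ifᵗ b then P else P′)    Q m = (Holds b m → wp P Q m) × (¬ Holds b m → wp P′ Q m)
    wp (while b loop P)          Q m = ⊥

    wp-weaken : ∀ {Q} Q′ P m → (∀ m′ → Q m′ → Q′ m′) → wp P Q m → wp P Q′ m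
    wp-weaken Q′ skip           m f q = f _ q
    wp-weaken Q′ (_ ⟨ _ ⟩≔ⁿ _) m f q = f _ q
    wp-weaken Q′ (_ ⟨ _ ⟩≔ʳ _) m f q = f _ q
    wp-weaken Q′ (P ⨟ P′)       m f q = wp-weaken (wp P′ Q′) P m (λ m′ → wp-weaken Q′ P′ m′ f) q
    wp-weaken Q′ (ifᵗ _ then P else P′) m f (q , q′) =
      (λ h → wp-weaken Q′ P m f (q h)) , λ ¬h → wp-weaken Q′ P′ m f (q′ ¬h)

    -- Only meaningful for programs without loops.
    bound : Program → ℕ
    bound skip                   = 1
    bound (a ⟨ i ⟩≔ⁿ e)          = suc (costⁿ i + costⁿ e)
    bound (a ⟨ i ⟩≔ʳ e)          = suc (costⁿ i + costʳ e)
    bound (P ⨟ P′)               = bound P + bound P′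
    bound (ifᵗ b then P else P′) = suc (costᵗ b + (bound P + bound P′))
    bound (while b loop P)       = 0

    -- A total-correctness triple with a time budget `c`.
    Runs : ℕ → Program → Memory → (Memory → Set) → Set
    Runs c P m Q = ∃₂ λ m′ t → ⟨ P , m ⟩⇓⟨ m′ , t ⟩ × t ≤ c × Q m′

    runs-seq : ∀ {c d P P′ m Q Q′} → Runs c P m Q → (∀ m′ → Q m′ → Runs d P′ m′ Q′) →
      Runs (c + d) (P ⨟ P′) m Q′
    runs-seq (m′ , t , P⇓ , t≤c , q) next with next m′ q
    ... | m″ , u , P′⇓ , u≤d , q′ = m″ , t + u , seq P⇓ P′⇓ , +-mono-≤ t≤c u≤d , q′

    -- The budgets of the branches are added, not maximised; a branch known to be impossible can be
    -- given budget 0.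
    runs-if : ∀ {b c d P P′ m Q} → (Holds b m → Runs c P m Q) → (¬ Holds b m → Runs d P′ m Q) →
      Runs (suc (costᵗ b + (c + d))) (ifᵗ b then P else P′) m Q
    runs-if {b} {c} {d} {m = m} yes-case no-case with evalᵗ b m in eq | reflects b m
    ... | true  | ofʸ  h with yes-case h
    ...   | m′ , t , P⇓ , t≤c , q = m′ , _ , if-true eq P⇓
          , s≤s (+-monoʳ-≤ (costᵗ b) (≤-trans t≤c (m≤m+n c d))) , q
    runs-if {b} {c} {d} {m = m} yes-case no-case | false | ofⁿ ¬h with no-case ¬h
    ...   | m′ , t , P⇓ , t≤d , q = m′ , _ , if-false eq P⇓
          , s≤s (+-monoʳ-≤ (costᵗ b) (≤-trans t≤d (m≤n+m d c))) , q

    runs : ∀ Q P m → wp P Q m → Runs (bound P) P m Q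
    runs Q skip           m q = _ , _ , skip , ≤-refl , q
    runs Q (a ⟨ i ⟩≔ⁿ e) m q = _ , _ , assignⁿ , ≤-refl , q
    runs Q (a ⟨ i ⟩≔ʳ e) m q = _ , _ , assignʳ , ≤-refl , q
    runs Q (P ⨟ P′)       m q = runs-seq (runs (wp P′ Q) P m q) (runs Q P′)
    runs Q (ifᵗ b then P else P′) m (q , q′) =
      runs-if {b} (λ h → runs Q P m (q h)) (λ ¬h → runs Q P′ m (q′ ¬h))

    runs-weaken : ∀ {c P m Q Q′} → (∀ m′ → Q m′ → Q′ m′) → Runs c P m Q → Runs c P m Q′
    runs-weaken f (m′ , t , P⇓ , t≤c , q) = m′ , t , P⇓ , t≤c , f m′ q

    runs-bound : ∀ {c d P m Q} → c ≤ d → Runs c P m Q → Runs d P m Q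
    runs-bound c≤d (m′ , t , P⇓ , t≤c , q) = m′ , t , P⇓ , ≤-trans t≤c c≤d , q

    whileBound : ℕ → Test → ℕ → ℕ
    whileBound r b c = r * (suc (costᵗ b) + c) + suc (costᵗ b)

    -- The index of `Inv` bounds the iterations still to come. At zero it must refute the test, but
    -- the loop may stop earlier, hence the existential `r′`.
    runs-while : ∀ {b P c} (Inv : ℕ → Memory → Set) →
      (∀ m → Inv 0 m → ¬ Holds b m) →
      (∀ r m → Inv (suc r) m → Holds b m → Runs c P m (Inv r)) →
      ∀ r m → Inv r m →
      Runs (whileBound r b c) (while b loop P) m (λ m′ → ¬ Holds b m′ × ∃ λ r′ → Inv r′ m′)
    runs-while {b} {P} {c} Inv exit step r m inv with evalᵗ b m in eq | reflects b m
    ... | false | ofⁿ ¬h = m , _ , while-false eq , m≤n+m _ _ , ¬h , r , inv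
    runs-while {b} {P} {c} Inv exit step zero m inv | true | ofʸ h = contradiction h (exit m inv)
    runs-while {b} {P} {c} Inv exit step (suc r) m inv | true | ofʸ h with step r m inv h
    ... | m′ , t , P⇓ , t≤c , inv′ with runs-while {b} {P} {c} Inv exit step r m′ inv′
    ... | m″ , u , W⇓ , u≤ , post = m″ , _ , while-true eq P⇓ W⇓
        , ≤-trans (+-mono-≤ (+-monoʳ-≤ (suc (costᵗ b)) t≤c) u≤)
            (≤-reflexive (sym (+-assoc (suc (costᵗ b) + c) _ _)))
        , post

    isYes-true : ∀ {P : Set} (P? : Dec P) → P → ⌊ P? ⌋ ≡ true
    isYes-true P? p = trans (isYes≗does P?) (dec-true P? p)

    isYes-false : ∀ {P : Set} (P? : Dec P) → ¬ P → ⌊ P? ⌋ ≡ false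
    isYes-false P? ¬p = trans (isYes≗does P?) (dec-false P? ¬p)

    update-same : ∀ {A : Set} (f : ℕ → ℕ → A) a i v → update f a i v a i ≡ v
    update-same f a i v
      rewrite isYes-true (a ≟ a) refl | isYes-true (i ≟ i) refl = refl

    update-index : ∀ {A : Set} (f : ℕ → ℕ → A) a i v {j} → i ≢ j → update f a i v a j ≡ f a j
    update-index f a i v {j} i≢j
      rewrite isYes-true (a ≟ a) refl | isYes-false (i ≟ j) i≢j = refl

    update-array : ∀ {A : Set} (f : ℕ → ℕ → A) a i v {b} → a ≢ b → ∀ j → update f a i v b j ≡ f b j
    update-array f a i v {b} a≢b j rewrite isYes-false (a ≟ b) a≢b = refl

    infix 4 _≔_ _<ⁿ_
    infixl 6 _⊓ⁿ_

    var : ℕ → NatExp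
    var a = a ⟨ lit 0 ⟩

    _≔_ : ℕ → NatExp → Program
    a ≔ e = a ⟨ lit 0 ⟩≔ⁿ e

    _<ⁿ_ : NatExp → NatExp → Test
    e <ⁿ f = lit 1 ⊕ e ≤ⁿ f

    -- Under truncated subtraction this is the minimum.
    _⊓ⁿ_ : NatExp → NatExp → NatExp
    e ⊓ⁿ f = e ⊖ (e ⊖ f)

    -- Array 0 holds the number of disks and array 6 the loop counter.
    for : Program → Program
    for P = 6 ≔ lit 0 ⨟ while var 6 <ⁿ var 0 loop (P ⨟ 6 ≔ lit 1 ⊕ var 6)

    forBound : ℕ → Program → ℕ
    forBound n P = bound (6 ≔ lit 0)
      + whileBound n (var 6 <ⁿ var 0) (bound P + bound (6 ≔ lit 1 ⊕ var 6))

    AtCounter : ℕ → (ℕ → Memory → Set) → ℕ → Memory → Set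
    AtCounter n Inv k m = nats m 6 0 ≡ k × nats m 0 0 ≡ n × Inv k m

    -- What the body must establish just before the counter is incremented: the invariant is
    -- asserted of the memory that the increment will produce.
    Stepped : ℕ → (ℕ → Memory → Set) → ℕ → Memory → Set
    Stepped n Inv k m = nats m 6 0 ≡ k × nats m 0 0 ≡ n
                      × Inv (suc k) (memory (update (nats m) 6 0 (suc (nats m 6 0))) (reals m))

    runs-for : ∀ n P (Inv : ℕ → Memory → Set) →
      (∀ k m → k < n → AtCounter n Inv k m → wp P (Stepped n Inv k) m) →
      ∀ m → nats m 0 0 ≡ n → Inv 0 (memory (update (nats m) 6 0 0) (reals m)) →
      Runs (forBound n P) (for P) m (λ m′ → nats m′ 0 0 ≡ n × Inv n m′)
    runs-for n P Inv step m m≡n inv = runs-seq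
      (runs (AtCounter n Inv 0) (6 ≔ lit 0) m (refl , m≡n , inv))
      λ m′ at → runs-weaken finish (runs-while Inv′ exit step′ n m′ (0 , refl , at))
      where
      body = P ⨟ 6 ≔ lit 1 ⊕ var 6

      Inv′ : ℕ → Memory → Set
      Inv′ r m = ∃ λ k → k + r ≡ n × AtCounter n Inv k m

      exit : ∀ m → Inv′ 0 m → ¬ Holds (var 6 <ⁿ var 0) m
      exit m (k , k+0≡n , k≡ , n≡ , _) k<n = <⇒≢ k<n (trans k≡ (trans (trans (sym (+-identityʳ k)) k+0≡n) (sym n≡)))

      step′ : ∀ r m → Inv′ (suc r) m → Holds (var 6 <ⁿ var 0) m → Runs (bound body) body m (Inv′ r)
      step′ r m (k , k+r≡n , at@(k≡ , n≡ , inv)) k<n = runs (Inv′ r) body m (wp-weaken (wp (6 ≔ lit 1 ⊕ var 6) (Inv′ r)) P m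
        (λ _ (k≡′ , n≡′ , inv′) → suc k , trans (sym (+-suc k r)) k+r≡n , cong suc k≡′ , n≡′ , inv′)
        (step k m (subst₂ _<_ k≡ n≡ k<n) at))

      finish : ∀ m → ¬ Holds (var 6 <ⁿ var 0) m × (∃ λ r → Inv′ r m) → nats m 0 0 ≡ n × Inv n m
      finish m (k≮n , r , k , k+r≡n , k≡ , n≡ , inv) = n≡ , subst (λ k → Inv k m) k≡n inv
        where
        k≡n : k ≡ n
        k≡n = ≤-antisym (≤-trans (m≤m+n k r) (≤-reflexive k+r≡n)) (subst₂ _≤_ n≡ k≡ (≮⇒≥ k≮n))

  -- Bottom-up merge sort

  module Sorting (ℝ : Reals) where
    open Reals ℝ using ()
      renaming (_≤_ to _≤ᴿ_; _≤?_ to _≤ᴿ?_; ≤-refl to ≤ᴿ-refl; ≤-trans to ≤ᴿ-trans; ≤-total to ≤ᴿ-total)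
    open RealRAM ℝ
    open ProgramLogic ℝ

    m∸[m∸n]≡m⊓n : ∀ m n → m ∸ (m ∸ n) ≡ m ⊓ n
    m∸[m∸n]≡m⊓n m n with ≤-total m n
    ... | inj₁ m≤n = trans (cong (m ∸_) (m≤n⇒m∸n≡0 m≤n)) (sym (m≤n⇒m⊓n≡m m≤n))
    ... | inj₂ n≤m = trans (m∸[m∸n]≡n n≤m) (sym (m≥n⇒m⊓n≡n n≤m))

    Frame : Memory → Memory → Set
    Frame m m′ = reals m′ ≡ reals m × nats m′ 0 ≡ nats m 0 × nats m′ 1 ≡ nats m 1
               × nats m′ 2 ≡ nats m 2 × nats m′ 3 ≡ nats m 3

    frame-trans : ∀ m m′ m″ → Frame m m′ → Frame m′ m″ → Frame m m″
    frame-trans _ _ _ (a , b , c , d , e) (a′ , b′ , c′ , d′ , e′) =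
      trans a′ a , trans b′ b , trans c′ c , trans d′ d , trans e′ e

    -- As an offset from 13, it is told apart from every lower array number by computation, even for
    -- a variable `s`.
    buffer : ℕ → ℕ
    buffer s = 13 + s

    -- Scalars: 7 and 8 delimit the rest of the left block, 9 and 10 that of the
    -- right block, and 11 holds the width of the blocks.
    module _ (a s d : ℕ) where

      -- The buffers hold disk indices and are compared through the real array `a`; coordinates
      -- never move, so data stored per disk survives sorting.
      key : NatExp → RealExp
      key e = a ⟨ buffer s ⟨ e ⟩ ⟩

      nextBlocks : Program
      nextBlocks =
        ifᵗ var 10 ≤ⁿ var 6
        then ( 7 ≔ var 6
             ⨟ 8 ≔ (var 6 ⊕ var 11) ⊓ⁿ var 0
             ⨟ 9 ≔ var 8
             ⨟ 10 ≔ (var 6 ⊕ (var 11 ⊕ var 11)) ⊓ⁿ var 0 )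
        else skip

      -- Tests have no disjunction, so "the right block is empty or its head is not smaller" is
      -- written by De Morgan. Reading past the end of a block is harmless, as arrays are unbounded.
      takeLeft : Test
      takeLeft = (var 7 <ⁿ var 8) andᵗ notᵗ ((var 9 <ⁿ var 10) andᵗ notᵗ (key (var 7) ≤ʳ key (var 9)))

      emitNext : Program
      emitNext =
        ifᵗ takeLeft
        then ( buffer d ⟨ var 6 ⟩≔ⁿ buffer s ⟨ var 7 ⟩ ⨟ 7 ≔ lit 1 ⊕ var 7 )
        else ( buffer d ⟨ var 6 ⟩≔ⁿ buffer s ⟨ var 9 ⟩ ⨟ 9 ≔ lit 1 ⊕ var 9 )

      resetBlocks : Program
      resetBlocks = 7 ≔ lit 0 ⨟ 8 ≔ lit 0 ⨟ 9 ≔ lit 0 ⨟ 10 ≔ lit 0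

      pass : Program
      pass = resetBlocks ⨟ for (nextBlocks ⨟ emitNext)

      passBound : ℕ → ℕ
      passBound n = bound resetBlocks + forBound n (nextBlocks ⨟ emitNext)

    module Pass (n a s d : ℕ) (s≢d : s ≢ d) (m₀ : Memory) where
      open Merging (λ i j → reals m₀ a i ≤ᴿ reals m₀ a j) ≤ᴿ-refl ≤ᴿ-trans n

      A = nats m₀ (buffer s)
      w = nats m₀ 11 0
      open Pass w A

      Inv : ℕ → Memory → Set
      -- The source buffer is preserved only pointwise: `s` and `d` are variables, so a write to one
      -- does not compute away from the other.
      Inv k m = Frame m₀ m × nats m 11 0 ≡ w × (∀ i → nats m (buffer s) i ≡ A i)
              × State k (nats m 7 0) (nats m 8 0) (nats m 9 0) (nats m 10 0) (nats m (buffer d))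

      cast : ∀ {k p pe q qe p′ pe′ q′ qe′ B} → p′ ≡ p → pe′ ≡ pe → q′ ≡ q → qe′ ≡ qe →
        State k p pe q qe B → State k p′ pe′ q′ qe′ B
      cast refl refl refl refl st = st

      emit-step : ∀ k m → nats m 6 0 ≡ k → nats m 0 0 ≡ n → Inv k m → k < nats m 10 0 →
        wp (emitNext a s d) (Stepped n Inv k) m
      emit-step k m@(memory N R) refl n≡ ((refl , frame) , w≡ , A≡ , st) k<qe =
        (λ (p<pe , ¬q≼p) → refl , n≡ , (refl , frame) , w≡ , kept
          , emitˡ k<qe p<pe (λ q<qe → least-left q<qe ¬q≼p) (written p) other st)
        , λ ¬left → refl , n≡ , (refl , frame) , w≡ , kept
          , emitʳ k<qe (λ p<pe → least-right p<pe ¬left) (written q) other st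
        where
        p = N 7 0
        q = N 9 0
        B = N (buffer d)
        d≢s : buffer d ≢ buffer s
        d≢s eq = s≢d (sym (+-cancelˡ-≡ 13 d s eq))

        kept : ∀ {v} i → update N (buffer d) k v (buffer s) i ≡ A i
        kept {v} i = trans (update-array N (buffer d) k v d≢s i) (A≡ i)

        written : ∀ l → update N (buffer d) k (N (buffer s) l) (buffer d) k ≡ A l
        written l = trans (update-same N (buffer d) k _) (A≡ l)

        other : ∀ {v i} → i ≢ k → update N (buffer d) k v (buffer d) i ≡ B i
        other {v} i≢k = update-index N (buffer d) k v (λ k≡i → i≢k (sym k≡i))

        KeyLess : ℕ → ℕ → Set
        KeyLess i j = R a i ≤ᴿ R a j

        least-left : q < N 10 0 → ¬ (q < N 10 0 × ¬ KeyLess (N (buffer s) p) (N (buffer s) q)) →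
          KeyLess (A p) (A q)
        least-left q<qe ¬q≼p with R a (N (buffer s) p) ≤ᴿ? R a (N (buffer s) q)
        ... | yes p≼q = subst₂ KeyLess (A≡ p) (A≡ q) p≼q
        ... | no  p⋠q = contradiction (q<qe , p⋠q) ¬q≼p

        least-right : p < N 8 0 → ¬ Holds (takeLeft a s d) m → q < N 10 0 × KeyLess (A q) (A p)
        least-right p<pe ¬left with q <? N 10 0
        ... | no  q≮qe = contradiction (p<pe , λ (q<qe , _) → q≮qe q<qe) ¬left
        ... | yes q<qe with ≤ᴿ-total (R a (N (buffer s) q)) (R a (N (buffer s) p))
        ...   | inj₁ q≼p = q<qe , subst₂ KeyLess (A≡ q) (A≡ p) q≼p
        ...   | inj₂ p≼q = contradiction (p<pe , λ (_ , p⋠q) → p⋠q p≼q) ¬left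

      Ready : ℕ → Memory → Set
      Ready k m = nats m 6 0 ≡ k × nats m 0 0 ≡ n × Inv k m × k < nats m 10 0

      blocks-step : 0 < w → Blocks w A n → ∀ k m → k < n → AtCounter n Inv k m →
        wp (nextBlocks a s d) (Ready k) m
      blocks-step 0<w sorted k m@(memory N R) k<n (refl , n≡ , inv@(frame , w≡ , A≡ , st)) =
        (λ qe≤k → let k<qe′ , st′ = advance 0<w sorted k<n qe≤k st in
          refl , n≡ , (frame , w≡ , A≡ , cast refl pe≡ pe≡ qe≡′ st′) , subst (k <_) (sym qe≡′) k<qe′)
        , λ qe≰k → refl , n≡ , inv , ≰⇒> qe≰k
        where
        min : ∀ x y → x ≡ y → x ∸ (x ∸ N 0 0) ≡ y ⊓ n
        min x y x≡y = trans (m∸[m∸n]≡m⊓n x (N 0 0)) (cong₂ _⊓_ x≡y n≡)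
        pe≡ = min (k + N 11 0) (k + w) (cong (k +_) w≡)
        qe≡′ = min (k + (N 11 0 + N 11 0)) (k + (w + w)) (cong (λ v → k + (v + v)) w≡)

      step : 0 < w → Blocks w A n → ∀ k m → k < n → AtCounter n Inv k m →
        wp (nextBlocks a s d ⨟ emitNext a s d) (Stepped n Inv k) m
      step 0<w sorted k m k<n at = wp-weaken {Ready k} (wp (emitNext a s d) (Stepped n Inv k)) (nextBlocks a s d) m
        (λ m′ (k≡ , n≡ , inv , k<qe) → emit-step k m′ k≡ n≡ inv k<qe)
        (blocks-step 0<w sorted k m k<n at)

      Passed : Memory → Set
      Passed m = Frame m₀ m × nats m 11 0 ≡ w
               × Blocks (w + w) (nats m (buffer d)) n × Permutation n (nats m (buffer d))

      Reset : Memory → Set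
      Reset m = nats m 0 0 ≡ n × Inv 0 (memory (update (nats m) 6 0 0) (reals m))

      pass-runs : nats m₀ 0 0 ≡ n → 0 < w → Blocks w A n → Permutation n A →
        Runs (passBound a s d n) (pass a s d) m₀ Passed
      pass-runs n≡ 0<w sorted perm = runs-seq
        (runs Reset (resetBlocks a s d) m₀ (n≡ , (refl , refl , refl , refl , refl) , refl , (λ _ → refl) , start))
        λ m (n≡ , inv) → runs-weaken
          (λ _ (_ , frame , w≡ , _ , st) → frame , w≡ , finish perm st)
          (runs-for n (nextBlocks a s d ⨟ emitNext a s d) Inv (step 0<w sorted) m n≡ inv)

    double : Program
    double = 11 ≔ var 11 ⊕ var 11

    -- Two passes bring the data back to buffer 0 without copying. If the first already sorts
    -- everything, the second preserves the order.
    twoPasses : ℕ → Program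
    twoPasses a = (pass a 0 1 ⨟ double) ⨟ (pass a 1 0 ⨟ double)

    unsorted : Test
    unsorted = var 11 <ⁿ var 0

    sort : ℕ → Program
    sort a = 11 ≔ lit 1 ⨟ while unsorted loop twoPasses a

    twoPassesBound : ℕ → ℕ → ℕ
    twoPassesBound n a = (passBound a 0 1 n + bound double) + (passBound a 1 0 n + bound double)

    sortBound : ℕ → ℕ → ℕ → ℕ
    sortBound n L a = bound (11 ≔ lit 1) + whileBound L unsorted (twoPassesBound n a)

    module Sort (n a : ℕ) (m₀ : Memory) where
      open Merging (λ i j → reals m₀ a i ≤ᴿ reals m₀ a j) ≤ᴿ-refl ≤ᴿ-trans n

      -- A round quadruples the width, while `r` counts it as one doubling; the slack costs only a
      -- constant factor.
      Inv : ℕ → Memory → Set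
      Inv r m = Frame m₀ m × 0 < nats m 11 0 × n ≤ nats m 11 0 * 2 ^ r
              × Blocks (nats m 11 0) (nats m 13) n × Permutation n (nats m 13)

      Sorted : Memory → Set
      Sorted m = Frame m₀ m × SortedOn (nats m 13) 0 n × Permutation n (nats m 13)

      sort-runs : ∀ L → nats m₀ 0 0 ≡ n → n ≤ 2 ^ L → Permutation n (nats m₀ 13) →
        Runs (sortBound n L a) (sort a) m₀ Sorted
      sort-runs L n≡ n≤2^L perm = runs-seq
        (runs (Inv L) (11 ≔ lit 1) m₀ ((refl , refl , refl , refl , refl) , s≤s z≤n
          , ≤-trans n≤2^L (≤-reflexive (sym (+-identityʳ _))) , singletons , perm))
        λ m inv → runs-weaken sorted (runs-while Inv exit step L m inv)
        where
        singletons : Blocks 1 (nats m₀ 13) n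
        singletons t {i} {j} t≤i i≤j j<t+1 _ = subst (λ l → reals m₀ a (nats m₀ 13 i) ≤ᴿ reals m₀ a (nats m₀ 13 l))
          (≤-antisym i≤j (≤-trans (m<1+n⇒m≤n (≤-trans j<t+1 (≤-reflexive (+-comm _ 1)))) t≤i)) ≤ᴿ-refl

        exit : ∀ m → Inv 0 m → ¬ Holds unsorted m
        exit m ((_ , n≡′ , _) , _ , n≤w , _) w<n = <⇒≱ w<n
          (≤-trans (≤-reflexive (trans (cong (λ f → f 0) n≡′) n≡)) (≤-trans n≤w (≤-reflexive (*-identityʳ _))))

        sorted : ∀ m → ¬ Holds unsorted m × ∃ (λ r → Inv r m) → Sorted m
        sorted m (w≮n , _ , frame@(_ , n≡′ , _) , _ , _ , blocks , perm) = frame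
          , (λ _ i≤j j<n → blocks 0 z≤n i≤j (<-≤-trans j<n n≤w) j<n) , perm
          where n≤w = ≤-trans (≤-reflexive (sym (trans (cong (λ f → f 0) n≡′) n≡))) (≮⇒≥ w≮n)

        Halfway : Memory → Memory → Set
        Halfway m m₁ = Frame m m₁ × nats m₁ 11 0 ≡ nats m 11 0 + nats m 11 0
          × Blocks (nats m 11 0 + nats m 11 0) (nats m₁ 14) n × Permutation n (nats m₁ 14)

        first : ∀ r m → Inv r m → Runs (passBound a 0 1 n + bound double) (pass a 0 1 ⨟ double) m (Halfway m)
        first r m@(memory N R) ((refl , n≡′ , _) , 0<w , _ , blocks , perm) = runs-seq
          (Pass.pass-runs n a 0 1 (λ ()) m (trans (cong (λ f → f 0) n≡′) n≡) 0<w blocks perm)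
          λ m₁ (f , w≡ , b , p) → runs (Halfway m) double m₁ (f , cong₂ _+_ w≡ w≡ , b , p)

        second : ∀ r m m₁ → Inv (suc r) m → Halfway m m₁ →
          Runs (passBound a 1 0 n + bound double) (pass a 1 0 ⨟ double) m₁ (Inv r)
        second r m@(memory N R) m₁@(memory N₁ _) (frame@(refl , n≡′ , _) , 0<w , n≤w2^r , _) (f@(refl , n≡₁ , _) , w≡ , b , p) =
          runs-seq
            (Pass.pass-runs n a 1 0 (λ ()) m₁ (trans (cong (λ f → f 0) n≡₁) (trans (cong (λ f → f 0) n≡′) n≡))
              (≤-trans 0<2w (≤-reflexive (sym w≡)))
              (subst (λ v → Blocks v (N₁ 14) n) (sym w≡) b) p)
            λ m₂ (f₂ , w≡₂ , b₂ , p₂) → runs (Inv r) double m₂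
              ( frame-trans m₀ m₁ m₂ (frame-trans m₀ m m₁ frame f) f₂
              , ≤-trans 0<2w (≤-trans (≤-reflexive (sym (trans w≡₂ w≡))) (m≤m+n _ _))
              , n≤4w2^r _ (trans w≡₂ w≡)
              , subst (λ v → Blocks v (nats m₂ 13) n) (cong₂ _+_ (sym w≡₂) (sym w≡₂)) b₂
              , p₂ )
          where
          w = N 11 0

          0<2w : 0 < w + w
          0<2w = ≤-trans 0<w (m≤m+n w w)

          n≤4w2^r : ∀ v → v ≡ w + w → n ≤ (v + v) * 2 ^ r
          n≤4w2^r v refl = ≤-trans n≤w2^r (≤-trans
            (≤-reflexive (trans (sym (*-assoc w 2 (2 ^ r))) (cong (_* 2 ^ r) (trans (*-comm w 2) (cong (w +_) (+-identityʳ w))))))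
            (*-monoˡ-≤ (2 ^ r) (m≤m+n (w + w) (w + w))))

        step : ∀ r m → Inv (suc r) m → Holds unsorted m → Runs (twoPassesBound n a) (twoPasses a) m (Inv r)
        step r m inv _ = runs-seq (first (suc r) m inv) λ m₁ half → second r m m₁ inv half

  -- Slabs and the greedy selection

  module Greedy (ℝ : Reals) where
    open Reals ℝ using (Carrier)
      renaming (_+_ to _+ᴿ_; _≤_ to _≤ᴿ_; ≤-refl to ≤ᴿ-refl; ≤-trans to ≤ᴿ-trans; ≤-total to ≤ᴿ-total;
                ≤-respˡ-≈ to ≤ᴿ-respˡ-≈; +-monoˡ-≤ to +ᴿ-monoˡ-≤; +-identityʳ to +ᴿ-identityʳ)
    open RealProperties ℝ using (0≤1) renaming (+-mono-≤ to +ᴿ-mono-≤)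
    open UnitDisks ℝ using (2#)
    open Field ℝ using () renaming (≰⇒≥ to ≰ᴿ⇒≥)
    open RealRAM ℝ
    open ProgramLogic ℝ
    open Sorting ℝ

    x≤x+2 : ∀ x → x ≤ᴿ x +ᴿ 2#
    x≤x+2 x = ≤ᴿ-respˡ-≈ (+ᴿ-identityʳ x) (+ᴿ-mono-≤ ≤ᴿ-refl
      (≤ᴿ-respˡ-≈ (+ᴿ-identityʳ _) (+ᴿ-mono-≤ 0≤1 0≤1)))

    ≡⇒≤ᴿ : ∀ {x y} → x ≡ y → x ≤ᴿ y
    ≡⇒≤ᴿ refl = ≤ᴿ-refl

    module Order (key : ℕ → Carrier) (n : ℕ) =
      Merging (λ i j → key i ≤ᴿ key j) ≤ᴿ-refl ≤ᴿ-trans n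

    module Slabs (n : ℕ) (X : ℕ → Carrier) (A : ℕ → ℕ) (sorted : Order.SortedOn X n A 0 n) where

      -- The bound `S i ≤ s` keeps the other two parts valid when a new slab writes `left (suc s)`.
      InSlab : ℕ → (ℕ → ℕ) → (ℕ → Carrier) → ℕ → Set
      InSlab s S left i = S i ≤ s × left (S i) ≤ᴿ X i × X i ≤ᴿ left (S i) +ᴿ 2#

      -- Slab c spans the abscissae from left c to left c + 2, and s is the last slab opened.
      record State (k s : ℕ) (S : ℕ → ℕ) (left : ℕ → Carrier) : Set where
        field
          inSlab : ∀ {l} → l < k → InSlab s S left (A l)
          gap    : ∀ {c} → c < s → ¬ left (suc c) ≤ᴿ left c +ᴿ 2#
          rest   : ∀ {l} → k ≤ l → l < n → left s ≤ᴿ X (A l)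

      open State

      extend : ∀ {k s S S′ left} → k < n → X (A k) ≤ᴿ left s +ᴿ 2# →
        S′ (A k) ≡ s → (∀ {i} → i ≢ A k → S′ i ≡ S i) → State k s S left → State (suc k) s S′ left
      extend {k} {s} {S} {S′} {left} k<n X≤ S′k S′i st = record
        { inSlab = λ l≤k → inSlab′ l≤k
        ; gap = gap st
        ; rest = λ k<l → rest st (<⇒≤ k<l) }
        where
        newest : ∀ {c} → c ≡ s → c ≤ s × left c ≤ᴿ X (A k) × X (A k) ≤ᴿ left c +ᴿ 2#
        newest refl = ≤-refl , rest st ≤-refl k<n , X≤

        inSlab′ : ∀ {l} → l < suc k → InSlab s S′ left (A l)
        inSlab′ {l} l≤k with A l ≟ A k
        ... | yes Al≡Ak = subst (InSlab s S′ left) (sym Al≡Ak) (newest S′k)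
        ... | no  Al≢Ak with m<1+n⇒m<n∨m≡n l≤k
        ...   | inj₂ l≡k = contradiction (cong A l≡k) Al≢Ak
        ...   | inj₁ l<k rewrite S′i Al≢Ak = inSlab st l<k

      -- Opening a slab does not advance `k`: it establishes the premise of `extend`, which then
      -- finishes both branches alike. The failed test is itself the new `gap`, and sortedness gives
      -- `rest`.
      open-slab : ∀ {k s S left left′} → k < n → ¬ X (A k) ≤ᴿ left s +ᴿ 2# →
        left′ (suc s) ≡ X (A k) → (∀ {c} → c ≢ suc s → left′ c ≡ left c) →
        State k s S left → X (A k) ≤ᴿ left′ (suc s) +ᴿ 2# × State k (suc s) S left′
      open-slab {k} {s} {S} {left} {left′} k<n X≰ left′s left′c st =
        ≤ᴿ-trans (≡⇒≤ᴿ (sym left′s)) (x≤x+2 _) , record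
        { inSlab = inSlab′
        ; gap = gap′
        ; rest = λ k≤l l<n → ≤ᴿ-trans (≡⇒≤ᴿ left′s) (sorted z≤n k≤l l<n) }
        where
        old : ∀ {c} → c ≤ s → left′ c ≡ left c
        old c≤s = left′c (<⇒≢ (s≤s c≤s))

        inSlab′ : ∀ {l} → l < k → InSlab (suc s) S left′ (A l)
        inSlab′ l<k with inSlab st l<k
        ... | S≤s , lo , hi rewrite old S≤s = m≤n⇒m≤1+n S≤s , lo , hi

        gap′ : ∀ {c} → c < suc s → ¬ left′ (suc c) ≤ᴿ left′ c +ᴿ 2#
        gap′ {c} c≤s with m<1+n⇒m<n∨m≡n c≤s
        ... | inj₁ c<s rewrite old c<s | old (<⇒≤ c<s) = gap st c<s
        ... | inj₂ refl rewrite left′s | old (≤-refl {c}) = X≰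

      module _ {s S left} (perm : Permutation n A) (st : State n s S left) where

        everywhere : ∀ {i} → i < n → InSlab s S left i
        everywhere i<n with Permutation.onto perm i<n
        ... | l , l<n , refl = inSlab st l<n

        left-mono : ∀ {c d} → c ≤ d → d ≤ s → left c ≤ᴿ left d
        left-mono {c} {zero}  z≤n _ = ≤ᴿ-refl
        left-mono {c} {suc d} c≤d d<s with m≤n⇒m<n∨m≡n c≤d
        ... | inj₂ refl = ≤ᴿ-refl
        ... | inj₁ (s≤s c≤d′) = ≤ᴿ-trans (left-mono c≤d′ (<⇒≤ d<s)) (≤ᴿ-trans (x≤x+2 _) (≰ᴿ⇒≥ (gap st d<s)))

        -- Two gaps are crossed: `X i ≤ left (S i) + 2 ≤ left (1 + S i)`, and `left (2 + S i) ≤ X j`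
        -- lies more than 2 beyond the latter.
        far : ∀ {i j} → i < n → j < n → 2 + S i ≤ S j → ¬ X j ≤ᴿ X i +ᴿ 2#
        far {i} {j} i<n j<n 2+Si≤Sj Xj≤ with everywhere i<n | everywhere j<n
        ... | _ , _ , Xi≤ | Sj≤s , ≤Xj , _ = gap st (≤-trans 2+Si≤Sj Sj≤s)
          (≤ᴿ-trans (left-mono 2+Si≤Sj Sj≤s) (≤ᴿ-trans ≤Xj (≤ᴿ-trans Xj≤
            (+ᴿ-monoˡ-≤ 2# (≤ᴿ-trans Xi≤ (≰ᴿ⇒≥ (gap st (≤-trans (n≤1+n _) (≤-trans 2+Si≤Sj Sj≤s)))))))))

    module Selection (n : ℕ) (Y : ℕ → Carrier) (S A : ℕ → ℕ) (sorted : Order.SortedOn Y n A 0 n) where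

      -- Which of the two is higher depends on the scan and not on the indices, hence the
      -- disjunction.
      Apart : ℕ → ℕ → Set
      Apart i j = ¬ Y j ≤ᴿ Y i +ᴿ 2# ⊎ ¬ Y i ≤ᴿ Y j +ᴿ 2#

      Covers : ℕ → ℕ → Set
      Covers o i = S o ≡ S i × Y o ≤ᴿ Y i × Y i ≤ᴿ Y o +ᴿ 2#

      -- last c is the ordinate of the disk selected last in slab c, if any.
      record State (k : ℕ) (out has : ℕ → ℕ) (last : ℕ → Carrier) : Set where
        field
          visited : ∀ {i} → out i ≡ 1 → ∃ λ l → l < k × A l ≡ i
          opened  : ∀ {i} → out i ≡ 1 → 1 ≤ has (S i) × Y i ≤ᴿ last (S i)
          topmost : ∀ {c} → 1 ≤ has c → ∃ λ o → out o ≡ 1 × S o ≡ c × Y o ≡ last c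
          apart   : ∀ {i j} → out i ≡ 1 → out j ≡ 1 → i ≢ j → S i ≡ S j → Apart i j
          covered : ∀ {l} → l < k → ∃ λ o → out o ≡ 1 × Covers o (A l)

      open State

      start : ∀ {out has last} → (∀ i → out i ≡ 0) → (∀ c → has c ≡ 0) → State 0 out has last
      start out≡0 has≡0 = record
        { visited = λ {i} out≡1 → contradiction (trans (sym (out≡0 i)) out≡1) λ ()
        ; opened  = λ {i} out≡1 → contradiction (trans (sym (out≡0 i)) out≡1) λ ()
        ; topmost = λ {c} 1≤has → contradiction (≤-trans 1≤has (≤-reflexive (has≡0 c))) λ ()
        ; apart   = λ {i} out≡1 → contradiction (trans (sym (out≡0 i)) out≡1) λ ()
        ; covered = λ () }

      module _ {k out has last} (k<n : k < n) (st : State k out has last) where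

        earlier : ∀ {i} → out i ≡ 1 → Y i ≤ᴿ Y (A k)
        earlier out≡1 with visited st out≡1
        ... | l , l<k , refl = sorted z≤n (<⇒≤ l<k) k<n

        visited′ : ∀ {i} → out i ≡ 1 → ∃ λ l → l < suc k × A l ≡ i
        visited′ out≡1 = let l , l<k , eq = visited st out≡1 in l , m<n⇒m<1+n l<k , eq

        -- The last selection of the slab covers the rejected disk: the scan order puts it no
        -- higher, and the test puts it within 2.
        drop : 1 ≤ has (S (A k)) → Y (A k) ≤ᴿ last (S (A k)) +ᴿ 2# → State (suc k) out has last
        drop 1≤has Y≤ = record
          { visited = visited′ ; opened = opened st ; topmost = topmost st ; apart = apart st
          ; covered = λ l≤k → [ covered st , (λ { refl → newest }) ]′ (m<1+n⇒m<n∨m≡n l≤k) }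
          where
          newest : ∃ λ o → out o ≡ 1 × Covers o (A k)
          newest with topmost st 1≤has
          ... | o , out≡1 , So , Yo = o , out≡1 , So , earlier out≡1
              , ≤ᴿ-trans Y≤ (+ᴿ-monoˡ-≤ 2# (≡⇒≤ᴿ (sym Yo)))

        module _ {out′ has′ : ℕ → ℕ} {last′ : ℕ → Carrier}
                 (free : ¬ (1 ≤ has (S (A k)) × Y (A k) ≤ᴿ last (S (A k)) +ᴿ 2#))
                 (out′k : out′ (A k) ≡ 1) (out′i : ∀ {i} → i ≢ A k → out′ i ≡ out i)
                 (has′k : has′ (S (A k)) ≡ 1) (has′c : ∀ {c} → c ≢ S (A k) → has′ c ≡ has c)
                 (last′k : last′ (S (A k)) ≡ Y (A k)) (last′c : ∀ {c} → c ≢ S (A k) → last′ c ≡ last c)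
                 where

          split : ∀ {i} → out′ i ≡ 1 → i ≡ A k ⊎ (i ≢ A k × out i ≡ 1)
          split {i} out≡1 with i ≟ A k
          ... | yes i≡ = inj₁ i≡
          ... | no  i≢ = inj₂ (i≢ , trans (sym (out′i i≢)) out≡1)

          join : ∀ {i} → out i ≡ 1 → out′ i ≡ 1
          join {i} out≡1 with i ≟ A k
          ... | yes refl = out′k
          ... | no  i≢   = trans (out′i i≢) out≡1

          at-top : ∀ {i} → S i ≡ S (A k) → Y i ≤ᴿ Y (A k) → 1 ≤ has′ (S i) × Y i ≤ᴿ last′ (S i)
          at-top S≡ Y≤ rewrite S≡ = ≤-reflexive (sym has′k) , ≤ᴿ-trans Y≤ (≡⇒≤ᴿ (sym last′k))

          opened′ : ∀ {i} → out′ i ≡ 1 → 1 ≤ has′ (S i) × Y i ≤ᴿ last′ (S i)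
          opened′ {i} out≡1 with split out≡1
          ... | inj₁ refl = at-top refl ≤ᴿ-refl
          ... | inj₂ (_ , out≡1′) with S i ≟ S (A k)
          ...   | yes S≡ = at-top S≡ (earlier out≡1′)
          ...   | no  S≢ rewrite has′c S≢ | last′c S≢ = opened st out≡1′

          topmost′ : ∀ {c} → 1 ≤ has′ c → ∃ λ o → out′ o ≡ 1 × S o ≡ c × Y o ≡ last′ c
          topmost′ {c} 1≤has with c ≟ S (A k)
          ... | yes refl = A k , out′k , refl , sym last′k
          ... | no  c≢ with topmost st (subst (1 ≤_) (has′c c≢) 1≤has)
          ...   | o , out≡1 , So , Yo = o , join out≡1 , So , trans Yo (sym (last′c c≢))

          -- Comparison with the last selection suffices, since by `opened` every other selected
          -- disk of the slab lies no higher.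
          above : ∀ {i} → out i ≡ 1 → S i ≡ S (A k) → ¬ Y (A k) ≤ᴿ Y i +ᴿ 2#
          above out≡1 S≡ Y≤ with opened st out≡1
          ... | 1≤has , Yi≤ rewrite S≡ = free (1≤has , ≤ᴿ-trans Y≤ (+ᴿ-monoˡ-≤ 2# Yi≤))

          apart′ : ∀ {i j} → out′ i ≡ 1 → out′ j ≡ 1 → i ≢ j → S i ≡ S j → Apart i j
          apart′ outi outj i≢j S≡ with split outi | split outj
          ... | inj₁ refl       | inj₁ refl       = contradiction refl i≢j
          ... | inj₁ refl       | inj₂ (_ , outj) = inj₂ (above outj (sym S≡))
          ... | inj₂ (_ , outi) | inj₁ refl       = inj₁ (above outi S≡)
          ... | inj₂ (_ , outi) | inj₂ (_ , outj) = apart st outi outj i≢j S≡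

          pick : State (suc k) out′ has′ last′
          pick = record
            { visited = λ out≡1 → [ (λ { refl → k , n<1+n k , refl }) , (λ (_ , out≡1) → visited′ out≡1) ]′ (split out≡1)
            ; opened = opened′
            ; topmost = topmost′
            ; apart = apart′
            ; covered = λ l≤k → [ (λ l<k → let o , out≡1 , c = covered st l<k in o , join out≡1 , c)
                                , (λ { refl → A k , out′k , refl , ≤ᴿ-refl , x≤x+2 _ }) ]′ (m<1+n⇒m<n∨m≡n l≤k) }

    -- Array 2 assigns slabs to disks and array 12 holds the current slab.
    disk# slab# : NatExp
    disk# = 13 ⟨ var 6 ⟩
    slab# = 2 ⟨ disk# ⟩

    two : RealExp
    two = oneʳ ⊕ oneʳ

    identity : Program
    identity = 13 ⟨ var 6 ⟩≔ⁿ var 6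

    firstSlab : Program
    firstSlab = 12 ≔ lit 0 ⨟ 2 ⟨ lit 0 ⟩≔ʳ 0 ⟨ 13 ⟨ lit 0 ⟩ ⟩

    chooseSlab : Program
    chooseSlab =
      ifᵗ 0 ⟨ disk# ⟩ ≤ʳ 2 ⟨ var 12 ⟩ ⊕ two
      then skip
      else ( 12 ≔ lit 1 ⊕ var 12 ⨟ 2 ⟨ var 12 ⟩≔ʳ 0 ⟨ disk# ⟩ )

    recordSlab : Program
    recordSlab = 2 ⟨ disk# ⟩≔ⁿ var 12

    -- Natural array 3 flags the slabs that contain a selected disk and real array 3 holds the
    -- latest ordinate. The flag is separate because an initial zero could also be an ordinate.
    selectDisk : Program
    selectDisk =
      ifᵗ (lit 1 ≤ⁿ 3 ⟨ slab# ⟩) andᵗ (1 ⟨ disk# ⟩ ≤ʳ 3 ⟨ slab# ⟩ ⊕ two)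
      then skip
      else ( 1 ⟨ disk# ⟩≔ⁿ lit 1 ⨟ 3 ⟨ slab# ⟩≔ⁿ lit 1 ⨟ 3 ⟨ slab# ⟩≔ʳ 1 ⟨ disk# ⟩ )

    -- Verification of the initial listing, the slab loop and the selection loop

    identity-runs : ∀ n m₀ → nats m₀ 0 0 ≡ n →
      Runs (forBound n identity) (for identity) m₀
        (λ m → Frame m₀ m × (∀ {i} → i < n → nats m 13 i ≡ i))
    identity-runs n m₀ n≡ = runs-weaken (λ _ → proj₂)
      (runs-for n identity Inv step m₀ n≡ ((refl , refl , refl , refl , refl) , λ ()))
      where
      Inv : ℕ → Memory → Set
      Inv k m = Frame m₀ m × (∀ {i} → i < k → nats m 13 i ≡ i)

      step : ∀ k m → k < n → AtCounter n Inv k m → wp identity (Stepped n Inv k) m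
      step k m@(memory N R) k<n (refl , n≡ , frame , id) = refl , n≡ , frame , id′
        where
        id′ : ∀ {i} → i < suc k → update N 13 k k 13 i ≡ i
        id′ {i} i≤k with m<1+n⇒m<n∨m≡n i≤k
        ... | inj₁ i<k  = trans (update-index N 13 k k (λ k≡i → <⇒≢ i<k (sym k≡i))) (id i<k)
        ... | inj₂ refl = update-same N 13 k k

    module SlabLoop (n : ℕ) (m₀ : Memory) where
      X = reals m₀ 0
      A = nats m₀ 13

      module _ (sorted : Order.SortedOn X n A 0 n) where
        open Slabs n X A sorted

        Kept : Memory → Set
        Kept m = reals m 0 ≡ X × reals m 1 ≡ reals m₀ 1
               × nats m 0 ≡ nats m₀ 0 × nats m 1 ≡ nats m₀ 1 × nats m 3 ≡ nats m₀ 3 × nats m 13 ≡ A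

        Inv : ℕ → Memory → Set
        Inv k m = Kept m × State k (nats m 12 0) (nats m 2) (reals m 2)

        Chosen : ℕ → Memory → Set
        Chosen k m = AtCounter n Inv k m × X (A k) ≤ᴿ reals m 2 (nats m 12 0) +ᴿ 2#

        choose : ∀ k m → k < n → AtCounter n Inv k m → wp chooseSlab (Chosen k) m
        choose k m@(memory N R) k<n (refl , n≡ , kept@(X≡ , _ , _ , _ , _ , A≡) , st) =
          (λ X≤ → (refl , n≡ , kept , st) , ≤ᴿ-trans (≡⇒≤ᴿ (sym XAk)) X≤)
          , λ X≰ → let X≤ , st′ = open-slab k<n (λ X≤ → X≰ (≤ᴿ-trans (≡⇒≤ᴿ XAk) X≤))
                                     (trans (update-same R 2 (suc (N 12 0)) _) XAk)
                                     (λ c≢ → update-index R 2 (suc (N 12 0)) _ (λ eq → c≢ (sym eq))) st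
                   in (refl , n≡ , kept , st′) , X≤
          where
          XAk : R 0 (N 13 k) ≡ X (A k)
          XAk = cong₂ (λ f g → f (g k)) X≡ A≡

        record-slab : ∀ k m → k < n → Chosen k m → wp recordSlab (Stepped n Inv k) m
        record-slab k m@(memory N R) k<n ((refl , n≡ , kept@(_ , _ , _ , _ , _ , A≡) , st) , X≤) =
          refl , n≡ , kept
          , extend k<n X≤ (trans (cong (update N 2 (N 13 k) (N 12 0) 2) (sym Ak)) (update-same N 2 (N 13 k) (N 12 0)))
              (λ i≢ → update-index N 2 (N 13 k) (N 12 0) (λ eq → i≢ (sym (trans (sym Ak) eq)))) st
          where
          Ak : N 13 k ≡ A k
          Ak = cong (λ g → g k) A≡

        body : Program
        body = chooseSlab ⨟ recordSlab

        Assigned : Memory → Set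
        Assigned m = Kept m × ∃ λ s → State n s (nats m 2) (reals m 2)

        slabs-run : nats m₀ 0 0 ≡ n →
          Runs (bound firstSlab + forBound n body) (firstSlab ⨟ for body) m₀ Assigned
        slabs-run n≡ = runs-seq
          -- Slab 0 starts at the leftmost disk before any disk is assigned; `rest` is then
          -- sortedness itself.
          (runs Begun firstSlab m₀ (n≡ , (refl , refl , refl , refl , refl , refl) , record
            { inSlab = λ () ; gap = λ () ; rest = λ _ l<n → sorted z≤n z≤n l<n }))
          λ m (n≡ , inv) → runs-weaken (λ m′ (_ , kept , st) → kept , nats m′ 12 0 , st)
            (runs-for n body Inv
              (λ k m k<n at → wp-weaken (wp recordSlab (Stepped n Inv k)) chooseSlab m
                 (λ m′ → record-slab k m′ k<n) (choose k m k<n at))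
              m n≡ inv)
          where
          Begun : Memory → Set
          Begun m = nats m 0 0 ≡ n × Inv 0 (memory (update (nats m) 6 0 0) (reals m))

    module SelectLoop (n : ℕ) (m₀ : Memory) where
      Y = reals m₀ 1
      S = nats m₀ 2
      A = nats m₀ 13

      module _ (sorted : Order.SortedOn Y n A 0 n) where
        open Selection n Y S A sorted

        Inv : ℕ → Memory → Set
        Inv k m = (reals m 1 ≡ Y × nats m 2 ≡ S × nats m 13 ≡ A)
                × State k (nats m 1) (nats m 3) (reals m 3)

        step : ∀ k m → k < n → AtCounter n Inv k m → wp selectDisk (Stepped n Inv k) m
        step k m@(memory N R) k<n (refl , n≡ , kept@(Y≡ , S≡ , A≡) , st) =
          (λ (1≤has , Y≤) → refl , n≡ , kept
            , drop k<n st (subst (λ c → 1 ≤ N 3 c) SAk 1≤has) (subst₂ (λ y c → y ≤ᴿ R 3 c +ᴿ 2#) YAk SAk Y≤))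
          , λ ¬both → refl , n≡ , kept
            , pick k<n st
                (λ (1≤has , Y≤) → ¬both ( subst (λ c → 1 ≤ N 3 c) (sym SAk) 1≤has
                                        , subst₂ (λ y c → y ≤ᴿ R 3 c +ᴿ 2#) (sym YAk) (sym SAk) Y≤ ))
                (same N 1 Ak) (other N 1 Ak)
                (same N 3 SAk) (other N 3 SAk)
                (trans (same R 3 SAk) YAk) (other R 3 SAk)
          where
          Ak : N 13 k ≡ A k
          Ak = cong (λ g → g k) A≡
          SAk : N 2 (N 13 k) ≡ S (A k)
          SAk = cong₂ (λ f g → f (g k)) S≡ A≡
          YAk : R 1 (N 13 k) ≡ Y (A k)
          YAk = cong₂ (λ f g → f (g k)) Y≡ A≡

          same : ∀ {C : Set} (f : ℕ → ℕ → C) a {i j v} → i ≡ j → update f a i v a j ≡ v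
          same f a {v = v} refl = update-same f a _ v

          other : ∀ {C : Set} (f : ℕ → ℕ → C) a {i j v} → i ≡ j → ∀ {l} → l ≢ j → update f a i v a l ≡ f a l
          other f a refl l≢j = update-index f a _ _ (λ eq → l≢j (sym eq))

        select-runs : nats m₀ 0 0 ≡ n → (∀ i → nats m₀ 1 i ≡ 0) → (∀ c → nats m₀ 3 c ≡ 0) →
          Runs (forBound n selectDisk) (for selectDisk) m₀
            (λ m → ∃₂ λ has last → State n (nats m 1) has last)
        select-runs n≡ out≡0 has≡0 = runs-weaken (λ m (_ , _ , st) → nats m 3 , reals m 3 , st)
          (runs-for n selectDisk Inv step m₀ n≡ ((refl , refl , refl) , start out≡0 has≡0))

  -- Running time

  -- The second argument will be the integer part of the logarithm; kept independent of `n`, it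
  -- makes all bounds polynomial.
  BigO : (f g : ℕ → ℕ → ℕ) → Set
  BigO f g = ∃ λ K → ∀ n l → 1 ≤ n → 1 ≤ l → f n l ≤ K * g n l

  linear linearithmic : ℕ → ℕ → ℕ
  linear       n l = n
  linearithmic n l = n * l

  O-+ : ∀ {f f′ g} → BigO f g → BigO f′ g → BigO (λ n l → f n l + f′ n l) g
  O-+ {g = g} (K , p) (K′ , p′) = K + K′ , λ n l 1≤n 1≤l →
    ≤-trans (+-mono-≤ (p n l 1≤n 1≤l) (p′ n l 1≤n 1≤l)) (≤-reflexive (sym (*-distribʳ-+ (g n l) K K′)))

  O-const : ∀ c → BigO (λ _ _ → c) linear
  O-const c = c , λ n l 1≤n _ → ≤-trans (≤-reflexive (sym (*-identityʳ c))) (*-monoʳ-≤ c 1≤n)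

  O-n* : ∀ c → BigO (λ n _ → n * c) linear
  O-n* c = c , λ n _ _ _ → ≤-reflexive (*-comm n c)

  O-lift : ∀ {f} → BigO f linear → BigO f linearithmic
  O-lift (K , p) = K , λ n l 1≤n 1≤l → ≤-trans (p n l 1≤n 1≤l)
    (*-monoʳ-≤ K (≤-trans (≤-reflexive (sym (*-identityʳ n))) (*-monoʳ-≤ n 1≤l)))

  -- Since `1 ≤ l`, the extra round in `suc l` costs no more than the bound on the other `l`, hence
  -- `K + K`.
  O-log* : ∀ {f} → BigO f linear → BigO (λ n l → suc l * f n l) linearithmic
  O-log* {f} (K , p) = K + K , λ n l 1≤n 1≤l →
    let Kn*l = ≤-trans (*-monoʳ-≤ l (p n l 1≤n 1≤l))
                 (≤-reflexive (trans (*-comm l (K * n)) (*-assoc K n l)))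
    in ≤-trans (+-mono-≤ (proj₂ (O-lift (K , p)) n l 1≤n 1≤l) Kn*l)
         (≤-reflexive (sym (*-distribʳ-+ (n * l) K K)))

  ⌊log₂_⌋-exists : ∀ n → 1 ≤ n → ∃ λ l → 2 ^ l ≤ n × n < 2 ^ suc l
  ⌊log₂ suc zero ⌋-exists _ = 0 , s≤s z≤n , s≤s (s≤s z≤n)
  ⌊log₂ suc (suc n) ⌋-exists _ with ⌊log₂ suc n ⌋-exists (s≤s z≤n)
  ... | l , lower , upper with suc (suc n) <? 2 ^ suc l
  ...   | yes n<  = l , m≤n⇒m≤1+n lower , n<
  ...   | no  n≮ = suc l , ≮⇒≥ n≮ , ≤-<-trans upper (^-monoʳ-< 2 (s≤s (s≤s z≤n)) (n<1+n (suc l)))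

  -- Assembly of the algorithm and its total cost

  module Main (ℝ : Reals) where
    open Reals ℝ using (Carrier) renaming (_+_ to _+ᴿ_; _≤_ to _≤ᴿ_)
    open UnitDisks ℝ using (2#)
    open RealRAM ℝ
    open ProgramLogic ℝ
    open Sorting ℝ
    open Greedy ℝ

    slabBody : Program
    slabBody = chooseSlab ⨟ recordSlab

    slabPhase selectPhase algorithm : Program
    slabPhase   = for identity ⨟ sort 0 ⨟ (firstSlab ⨟ for slabBody)
    selectPhase = sort 1 ⨟ for selectDisk
    algorithm   = slabPhase ⨟ selectPhase

    slabPhaseBound selectPhaseBound algorithmBound : ℕ → ℕ → ℕ
    slabPhaseBound n l   = forBound n identity + (sortBound n (suc l) 0 + (bound firstSlab + forBound n slabBody))
    selectPhaseBound n l = sortBound n (suc l) 1 + forBound n selectDisk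
    algorithmBound n l   = slabPhaseBound n l + selectPhaseBound n l

    O-for : ∀ P → BigO (λ n _ → forBound n P) linear
    O-for P = O-+ (O-const (bound (6 ≔ lit 0)))
      (O-+ (O-n* (suc (costᵗ continue) + (bound P + bound (6 ≔ lit 1 ⊕ var 6))))
           (O-const (suc (costᵗ continue))))
      where continue = var 6 <ⁿ var 0

    O-pass : ∀ a s d → BigO (λ n _ → passBound a s d n) linear
    O-pass a s d = O-+ (O-const (bound (resetBlocks a s d))) (O-for (nextBlocks a s d ⨟ emitNext a s d))

    O-sort : ∀ a → BigO (λ n l → sortBound n (suc l) a) linearithmic
    O-sort a = O-+ (O-lift (O-const (bound (11 ≔ lit 1))))
      (O-+ (O-log* (O-+ (O-const (suc (costᵗ unsorted)))
              (O-+ (O-+ (O-pass a 0 1) (O-const (bound double))) (O-+ (O-pass a 1 0) (O-const (bound double))))))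
           (O-lift (O-const (suc (costᵗ unsorted)))))

    O-algorithm : BigO algorithmBound linearithmic
    O-algorithm = O-+
      (O-+ (O-lift (O-for identity)) (O-+ (O-sort 0) (O-lift (O-+ (O-const (bound firstSlab)) (O-for slabBody)))))
      (O-+ (O-sort 1) (O-lift (O-for selectDisk)))

    module _ (n : ℕ) (X Y : ℕ → Carrier) where

      -- Stated for disks rather than for positions in the sorted order, so that it outlives the
      -- second sort.
      Slabbed : (ℕ → ℕ) → (ℕ → Carrier) → Set
      Slabbed S left = (∀ {i} → i < n → left (S i) ≤ᴿ X i × X i ≤ᴿ left (S i) +ᴿ 2#)
                     × (∀ {i j} → i < n → j < n → 2 + S i ≤ S j → ¬ X j ≤ᴿ X i +ᴿ 2#)

      Selected : (S out : ℕ → ℕ) → Set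
      Selected S out =
          (∀ {i j} → out i ≡ 1 → out j ≡ 1 → i ≢ j → S i ≡ S j → ¬ Y j ≤ᴿ Y i +ᴿ 2# ⊎ ¬ Y i ≤ᴿ Y j +ᴿ 2#)
        × (∀ {i} → i < n → ∃ λ o → o < n × out o ≡ 1 × S o ≡ S i × Y o ≤ᴿ Y i × Y i ≤ᴿ Y o +ᴿ 2#)

      Blank : Memory → Set
      Blank m = nats m 0 0 ≡ n × (∀ i → nats m 1 i ≡ 0) × (∀ c → nats m 3 c ≡ 0)
              × reals m 0 ≡ X × reals m 1 ≡ Y

      Midway : Memory → Set
      Midway m = Blank m × Permutation n (nats m 13) × ∃ (Slabbed (nats m 2))

      Solved : Memory → Set
      Solved m = ∃₂ λ S left → Slabbed S left × Selected S (nats m 1)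

      blank-frame : ∀ m m′ → Frame m m′ → Blank m → Blank m′
      blank-frame m m′ (R≡ , N0 , N1 , _ , N3) (n≡ , out , has , X≡ , Y≡) =
        trans (cong (λ f → f 0) N0) n≡
        , (λ i → trans (cong (λ f → f i) N1) (out i))
        , (λ c → trans (cong (λ f → f c) N3) (has c))
        , trans (cong (λ f → f 0) R≡) X≡ , trans (cong (λ f → f 1) R≡) Y≡

      Listed Ordered : Memory → Set
      Listed m = Blank m × Permutation n (nats m 13)
      Ordered m = Listed m × Order.SortedOn (reals m 0) n (nats m 13) 0 n

      slabs-run : ∀ m → Ordered m →
        Runs (bound firstSlab + forBound n slabBody) (firstSlab ⨟ for slabBody) m Midway
      slabs-run m (((n≡ , out , has , refl , Y≡) , perm) , sorted) = runs-weaken midway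
        (SlabLoop.slabs-run n m sorted n≡)
        where
        midway : ∀ m′ → SlabLoop.Assigned n m sorted m′ → Midway m′
        midway m′ ((X≡ , Y≡′ , N0 , N1 , N3 , A≡) , s , st) =
          (trans (cong (λ f → f 0) N0) n≡
          , (λ i → trans (cong (λ f → f i) N1) (out i))
          , (λ c → trans (cong (λ f → f c) N3) (has c))
          , X≡ , trans Y≡′ Y≡)
          , subst (Permutation n) (sym A≡) perm
          , reals m′ 2
          , (λ i<n → proj₂ (Slabs.everywhere n (reals m 0) (nats m 13) sorted perm st i<n))
          , (λ i<n j<n → Slabs.far n (reals m 0) (nats m 13) sorted perm st i<n j<n)

      slabPhase-runs : ∀ l m → n ≤ 2 ^ suc l → Blank m → Runs (slabPhaseBound n l) slabPhase m Midway
      slabPhase-runs l m n≤ blank@(n≡ , _) = runs-seq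
        (runs-weaken listed (identity-runs n m n≡))
        λ m₁ (blank₁@(n≡₁ , _) , perm) → runs-seq
          (runs-weaken (ordered m₁ blank₁) (Sort.sort-runs n 0 m₁ (suc l) n≡₁ n≤ perm))
          slabs-run
        where
        listed : ∀ m₁ → Frame m m₁ × (∀ {i} → i < n → nats m₁ 13 i ≡ i) → Listed m₁
        listed m₁ (frame , id) = blank-frame m m₁ frame blank , record
          { bounded = λ k<n → subst (_< n) (sym (id k<n)) k<n
          ; onto = λ {i} i<n → i , i<n , id i<n }

        ordered : ∀ m₁ → Blank m₁ → ∀ m₂ → Sort.Sorted n 0 m₁ m₂ → Ordered m₂
        ordered m₁ blank₁ m₂@(memory _ _) (frame@(refl , _) , sorted , perm) =
          (blank-frame m₁ m₂ frame blank₁ , perm) , sorted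

      selectPhase-runs : ∀ l m → n ≤ 2 ^ suc l → Midway m → Runs (selectPhaseBound n l) selectPhase m Solved
      selectPhase-runs l m n≤ (blank@(n≡ , _) , perm , left , slabbed) = runs-seq
        (Sort.sort-runs n 1 m (suc l) n≡ n≤ perm) select
        where
        select : ∀ m₁ → Sort.Sorted n 1 m m₁ → Runs (forBound n selectDisk) (for selectDisk) m₁ Solved
        select m₁@(memory N R) (frame@(refl , _ , _ , S≡ , _) , sorted , perm′) with blank-frame m m₁ frame blank
        ... | n≡₁ , out , has , _ , refl = runs-weaken solved
          (SelectLoop.select-runs n m₁ sorted n≡₁ out has)
          where
          open Selection n (R 1) (N 2) (N 13) sorted
          solved : ∀ m₂ → (∃₂ λ has last → State n (nats m₂ 1) has last) → Solved m₂
          solved m₂ (_ , _ , st) = N 2 , left , subst (λ S → Slabbed S left) (sym S≡) slabbed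
            , State.apart st , cover
            where
            cover : ∀ {i} → i < n →
              ∃ λ o → o < n × nats m₂ 1 o ≡ 1 × N 2 o ≡ N 2 i × R 1 o ≤ᴿ R 1 i × R 1 i ≤ᴿ R 1 o +ᴿ 2#
            cover i<n with Permutation.onto perm′ i<n
            ... | l , l<n , refl with State.covered st l<n
            ...   | o , out≡1 , covers with State.visited st out≡1
            ...     | k , k<n , refl = o , Permutation.bounded perm′ k<n , out≡1 , covers

      algorithm-runs : ∀ l m → n ≤ 2 ^ suc l → Blank m → Runs (algorithmBound n l) algorithm m Solved
      algorithm-runs l m n≤ blank = runs-seq (slabPhase-runs l m n≤ blank) λ m₁ → selectPhase-runs l m₁ n≤

  -- Approximation ratio

  -- This is `n / 2 ≤ 2 log n` with the logarithm cleared, a finite check. It fails at 1 and at 17.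
  2^n≤n^4 : ∀ {n} → n ≤ 16 → 2 ≤ n → 2 ^ n ≤ n ^ 4
  2^n≤n^4 n≤16 = toWitness {a? = allUpTo? (λ n → (2 ≤? n) →-dec (2 ^ n ≤? n ^ 4)) 17} tt (s≤s n≤16)

  even : ℕ → Bool
  even zero    = true
  even (suc n) = not (even n)

  even-gap : ∀ {m n} → even m ≡ even n → m < n → 2 + m ≤ n
  even-gap {m} eq m<n with m≤n⇒m<n∨m≡n m<n
  ... | inj₁ 1+m<n = 1+m<n
  ... | inj₂ refl  = contradiction eq (not-¬ refl)

  module Approximation (ℝ : Reals) where
    open Reals ℝ using
      (Carrier; _≈_; _-_; _/_; 1#; fromℕ; ≈-trans; ≤-respˡ-≈; +-cong; *-congʳ; ·-homo-+; ·1-homo-*)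
      renaming (_≤_ to _≤ᴿ_; _+_ to _+ᴿ_; _*_ to _*ᴿ_; ≤-trans to ≤ᴿ-trans; ≤-refl to ≤ᴿ-refl;
                ≤-reflexive to ≤ᴿ-reflexive; _≤?_ to _≤ᴿ?_; +-identityʳ to +ᴿ-identityʳ; +-identityˡ to +ᴿ-identityˡ;
                *-identityˡ to *ᴿ-identityˡ)
    open RealProperties ℝ using (log₂; square-nonNeg; fromℕ-nonNeg; fromℕ-mono-≤)
      renaming (+-mono-≤ to +ᴿ-mono-≤)
    open UnitDisks ℝ
    open RealRAM ℝ
    open ProgramLogic ℝ
    open Main ℝ
    open Field ℝ using (square≤4; same-half; 1+1≤4; log₂-≥; ratio; approximates-≤; approximates-log)
      renaming (*-monoˡ-≤ to *ᴿ-monoˡ-≤)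

    -- From the final memory to the selected subgraph

    ∈-output⁻ : ∀ {n m} {i : Fin n} → i ∈ output n m → nats m 1 (toℕ i) ≡ 1
    ∈-output⁻ {n} {m} {i} i∈ with nats m 1 (toℕ i) ≟ 1
      | trans (sym (lookup∘tabulate (λ i → ⌊ nats m 1 (toℕ i) ≟ 1 ⌋) i)) ([]=⇒lookup i∈)
    ... | yes out≡1 | _ = out≡1

    ∈-output⁺ : ∀ {n m} {i : Fin n} → nats m 1 (toℕ i) ≡ 1 → i ∈ output n m
    ∈-output⁺ {n} {m} {i} out≡1 = lookup⇒[]= i _
      (trans (lookup∘tabulate (λ i → ⌊ nats m 1 (toℕ i) ≟ 1 ⌋) i) (isYes-true (nats m 1 (toℕ i) ≟ 1) out≡1))

    intersect-sym : ∀ {A B} → Intersect A B → Intersect B A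
    intersect-sym (p , p∈A , p∈B) = p , p∈B , p∈A

    module _ {n : ℕ} (D : Fin n → UnitDisk) where

      X Y : ℕ → Carrier
      X = reals (input D) 0
      Y = reals (input D) 1

      abscissa : ∀ i → X (toℕ i) ≡ proj₁ (centre (D i))
      abscissa i with toℕ i <? n
      ... | yes i<n = cong (λ i → proj₁ (centre (D i))) (fromℕ<-toℕ i i<n)
      ... | no  i≮n = contradiction (toℕ<n i) i≮n

      ordinate : ∀ i → Y (toℕ i) ≡ proj₂ (centre (D i))
      ordinate i with toℕ i <? n
      ... | yes i<n = cong (λ i → proj₂ (centre (D i))) (fromℕ<-toℕ i i<n)
      ... | no  i≮n = contradiction (toℕ<n i) i≮n

      square : Carrier → Carrier → Carrier
      square x y = (x - y) *ᴿ (x - y)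

      dist²≡ : ∀ i j → dist² (centre (D i)) (centre (D j)) ≡
        square (X (toℕ i)) (X (toℕ j)) +ᴿ square (Y (toℕ i)) (Y (toℕ j))
      dist²≡ i j rewrite abscissa i | abscissa j | ordinate i | ordinate j = refl

      squares≤4 : ∀ i j → Intersect (D i) (D j) →
        square (X (toℕ i)) (X (toℕ j)) ≤ᴿ 4# × square (Y (toℕ i)) (Y (toℕ j)) ≤ᴿ 4#
      squares≤4 i j meet =
          ≤ᴿ-trans (≤-respˡ-≈ (+ᴿ-identityʳ _) (+ᴿ-mono-≤ ≤ᴿ-refl (square-nonNeg _))) near
        , ≤ᴿ-trans (≤-respˡ-≈ (+ᴿ-identityˡ _) (+ᴿ-mono-≤ (square-nonNeg _) ≤ᴿ-refl)) near
        where
        near : square (X (toℕ i)) (X (toℕ j)) +ᴿ square (Y (toℕ i)) (Y (toℕ j)) ≤ᴿ 4#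
        near = subst (_≤ᴿ 4#) (dist²≡ i j) (intersect⇒near (D i) (D j) meet)

      module _ (m : Memory) (solved : Solved n X Y m) where

        S = proj₁ solved
        left = proj₁ (proj₂ solved)
        inSlab : ∀ {i} → i < n → left (S i) ≤ᴿ X i × X i ≤ᴿ left (S i) +ᴿ 2#
        inSlab = proj₁ (proj₁ (proj₂ (proj₂ solved)))
        far : ∀ {i j} → i < n → j < n → 2 + S i ≤ S j → ¬ X j ≤ᴿ X i +ᴿ 2#
        far = proj₂ (proj₁ (proj₂ (proj₂ solved)))
        apart : ∀ {i j} → nats m 1 i ≡ 1 → nats m 1 j ≡ 1 → i ≢ j → S i ≡ S j →
          ¬ Y j ≤ᴿ Y i +ᴿ 2# ⊎ ¬ Y i ≤ᴿ Y j +ᴿ 2#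
        apart = proj₁ (proj₂ (proj₂ (proj₂ solved)))
        cover : ∀ {i} → i < n → ∃ λ o → o < n × nats m 1 o ≡ 1 × S o ≡ S i × Y o ≤ᴿ Y i × Y i ≤ᴿ Y o +ᴿ 2#
        cover = proj₂ (proj₂ (proj₂ (proj₂ solved)))

        output-bipartite : Bipartite (intersectionGraph D [ output n m ])
        output-bipartite = (λ (i , _) → even (S (toℕ i))) , λ {u} {v} → proper {u} {v}
          where
          proper : ∀ {u v : ∃ (_∈ output n m)} → Adj (intersectionGraph D [ output n m ]) u v →
            even (S (toℕ (proj₁ u))) ≢ even (S (toℕ (proj₁ v)))
          proper {i , i∈} {j , j∈} (i≢j , meet) eq with <-cmp (S (toℕ i)) (S (toℕ j))
          ... | tri< Si<Sj _ _ = far (toℕ<n i) (toℕ<n j) (even-gap eq Si<Sj) (square≤4 (proj₁ (squares≤4 i j meet)))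
          ... | tri> _ _ Sj<Si = far (toℕ<n j) (toℕ<n i) (even-gap (sym eq) Sj<Si)
                (square≤4 (proj₁ (squares≤4 j i (intersect-sym meet))))
          ... | tri≈ _ Si≡Sj _ with apart (∈-output⁻ {m = m} i∈) (∈-output⁻ {m = m} j∈) (λ eq → i≢j (toℕ-injective eq)) Si≡Sj
          ...   | inj₁ ¬close = ¬close (square≤4 (proj₂ (squares≤4 i j meet)))
          ...   | inj₂ ¬close = ¬close (square≤4 (proj₂ (squares≤4 j i (intersect-sym meet))))

        -- A disk of `M` is charged to the selected disk covering it, with one bit for its colour
        -- and one per axis for its cell, so `8 = 2 * 2 * 2`. Distinct disks agreeing in all of
        -- these would be adjacent and equally coloured.
        card-bipartite : ∀ M → Bipartite (intersectionGraph D [ M ]) → ∣ M ∣ ≤ ∣ output n m ∣ * 8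
        card-bipartite M (colour , proper) = card-≤ M (output n m) owner label injective
          where
          top : Fin n → ℕ
          top i = proj₁ (cover (toℕ<n i))

          top<n : ∀ i → top i < n
          top<n i = proj₁ (proj₂ (cover (toℕ<n i)))

          owner : ∃ (_∈ M) → ∃ (_∈ output n m)
          owner (i , _) = fromℕ< (top<n i) , ∈-output⁺ {m = m}
            (trans (cong (nats m 1) (toℕ-fromℕ< (top<n i))) (proj₁ (proj₂ (proj₂ (cover (toℕ<n i))))))

          -- The box is bounded by the slab horizontally and starts at the ordinate of the selected
          -- disk vertically.
          cellˣ cellʸ : Fin n → Bool
          cellˣ i = ⌊ X (toℕ i) ≤ᴿ? left (S (toℕ i)) +ᴿ 1# ⌋
          cellʸ i = ⌊ Y (toℕ i) ≤ᴿ? Y (top i) +ᴿ 1# ⌋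

          label : ∃ (_∈ M) → Fin 8
          label (i , i∈) = combine (combine (bit (colour (i , i∈))) (bit (cellˣ i))) (bit (cellʸ i))

          S-top : ∀ i → S (top i) ≡ S (toℕ i)
          S-top i = proj₁ (proj₂ (proj₂ (proj₂ (cover (toℕ<n i)))))

          near : ∀ i j → top i ≡ top j → cellˣ i ≡ cellˣ j → cellʸ i ≡ cellʸ j →
            dist² (centre (D i)) (centre (D j)) ≤ᴿ 4#
          near i j top≡ cellˣ≡ cellʸ≡ = subst (_≤ᴿ 4#) (sym (dist²≡ i j))
            (≤ᴿ-trans (+ᴿ-mono-≤
              (same-half (subst (λ c → left c ≤ᴿ Xi × Xi ≤ᴿ left c +ᴿ 2#) S≡ (inSlab (toℕ<n i))) (inSlab (toℕ<n j))
                (subst (λ c → ⌊ Xi ≤ᴿ? left c +ᴿ 1# ⌋ ≡ cellˣ j) S≡ cellˣ≡))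
              (same-half (subst (λ o → Y o ≤ᴿ Yi × Yi ≤ᴿ Y o +ᴿ 2#) top≡ (inBox i)) (inBox j)
                (subst (λ o → ⌊ Yi ≤ᴿ? Y o +ᴿ 1# ⌋ ≡ cellʸ j) top≡ cellʸ≡))) 1+1≤4)
            where
            Xi = X (toℕ i)
            Yi = Y (toℕ i)
            S≡ : S (toℕ i) ≡ S (toℕ j)
            S≡ = trans (sym (S-top i)) (trans (cong S top≡) (S-top j))
            inBox : ∀ i → Y (top i) ≤ᴿ Y (toℕ i) × Y (toℕ i) ≤ᴿ Y (top i) +ᴿ 2#
            inBox i = proj₂ (proj₂ (proj₂ (proj₂ (cover (toℕ<n i)))))

          injective : ∀ u v → proj₁ (owner u) ≡ proj₁ (owner v) → label u ≡ label v → proj₁ u ≡ proj₁ v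
          injective (i , i∈) (j , j∈) owner≡ label≡ with i Fin.≟ j
          ... | yes i≡j = i≡j
          ... | no  i≢j =
            let pair≡ , cellʸ≡ = combine-injective (combine (bit (colour (i , i∈))) (bit (cellˣ i))) (bit (cellʸ i)) _ _ label≡
                colour≡ , cellˣ≡ = combine-injective (bit (colour (i , i∈))) (bit (cellˣ i)) _ _ pair≡
                top≡ = trans (sym (toℕ-fromℕ< (top<n i))) (trans (cong toℕ owner≡) (toℕ-fromℕ< (top<n j)))
            in contradiction (bit-injective colour≡)
                 (proper {i , i∈} {j , j∈} (i≢j , near⇒intersect (D i) (D j)
                   (near i j top≡ (bit-injective cellˣ≡) (bit-injective cellʸ≡))))

    -- At most 16 disks

    -- For `n = 1` the second write lies beyond the disks, where `output` does not look.
    firstTwo : Program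
    firstTwo = 1 ⟨ lit 0 ⟩≔ⁿ lit 1 ⨟ 1 ⟨ lit 1 ⟩≔ⁿ lit 1

    FirstTwo : Memory → Set
    FirstTwo m = nats m 1 0 ≡ 1 × nats m 1 1 ≡ 1 × (∀ i → nats m 1 (2 + i) ≡ 0)

    firstTwo-bipartite : ∀ {n} (D : Fin n → UnitDisk) m → FirstTwo m →
      Bipartite (intersectionGraph D [ output n m ])
    firstTwo-bipartite {n} D m (_ , _ , rest) = (λ (i , _) → even (toℕ i)) , λ {u} {v} → proper {u} {v}
      where
      only : ∀ {i : Fin n} → i ∈ output n m → toℕ i < 2
      only {i} i∈ with toℕ i | ∈-output⁻ {m = m} i∈
      ... | 0 | _ = s≤s z≤n
      ... | 1 | _ = s≤s (s≤s z≤n)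
      ... | suc (suc k) | out≡1 = contradiction (trans (sym (rest k)) out≡1) λ ()

      same : ∀ {k l} → k < 2 → l < 2 → even k ≡ even l → k ≡ l
      same {0} {0} _ _ _ = refl
      same {1} {1} _ _ _ = refl
      same {0} {1} _ _ ()
      same {1} {0} _ _ ()
      same {suc (suc k)} (s≤s (s≤s ())) _ _
      same {_} {suc (suc l)} _ (s≤s (s≤s ())) _

      proper : ∀ {u v : ∃ (_∈ output n m)} → Adj (intersectionGraph D [ output n m ]) u v →
        even (toℕ (proj₁ u)) ≢ even (toℕ (proj₁ v))
      proper {i , i∈} {j , j∈} (i≢j , _) eq = i≢j (toℕ-injective (same (only i∈) (only j∈) eq))

    firstTwo-card : ∀ n m → FirstTwo m → 2 ≤ n → 2 ≤ ∣ output n m ∣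
    firstTwo-card (suc (suc n)) m (out0 , out1 , _) _ rewrite out0 | out1 = s≤s (s≤s z≤n)
    firstTwo-card 1 m _ (s≤s ())

    firstTwo-all : ∀ n m → FirstTwo m → n ≤ 1 → n ≤ ∣ output n m ∣
    firstTwo-all 0 m _ _ = z≤n
    firstTwo-all 1 m (out0 , _) _ rewrite out0 = s≤s z≤n
    firstTwo-all (suc (suc n)) m _ (s≤s ())

    firstTwo-approximates : ∀ n .{{_ : NonZero n}} m → FirstTwo m → n ≤ 16 → ∀ (M : Subset n) →
      fromℕ ∣ M ∣ / ratio n ≤ᴿ fromℕ ∣ output n m ∣
    firstTwo-approximates n m two n≤16 M with 2 ≤? n
    -- The argument `1` before the power inequality makes the denominator `suc 1 = 2`, the size
    -- guaranteed for the output, and the exponent 4.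
    ... | yes 2≤n = approximates-log n (∣ M ∣) (∣ output n m ∣) 1 n 1 (2^n≤n^4 n≤16 2≤n)
      (≤-trans (∣p∣≤n M) (≤-reflexive (sym (*-identityˡ n)))) (firstTwo-card n m two 2≤n)
    ... | no  2≰n = approximates-≤ n (∣ M ∣) (∣ output n m ∣)
      (≤-trans (∣p∣≤n M) (firstTwo-all n m two (m<1+n⇒m≤n (≰⇒> 2≰n))))

    -- The combined program: running time and correctness

    few : Test
    few = var 0 ≤ⁿ lit 16

    program : Program
    program = ifᵗ few then firstTwo else algorithm

    -- The summand `1#` absorbs the constant overhead, which `n log n` alone cannot do at `n = 1`.
    time-bound : ∀ overhead factor n .{{_ : NonZero n}} l t e → 2 ^ l ≤ n → t ≤ overhead + factor * (n * l) →
      fromℕ t ≤ᴿ fromℕ (overhead + factor) *ᴿ (fromℕ n *ᴿ log₂ n +ᴿ fromℕ e +ᴿ 1#)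
    time-bound overhead factor n l t e 2^l≤n t≤ = ≤ᴿ-trans (fromℕ-mono-≤ (≤-trans t≤ distribute))
      (≤ᴿ-trans (≤ᴿ-reflexive (·1-homo-* (overhead + factor) (n * l + 1)))
        (*ᴿ-monoˡ-≤ (fromℕ-nonNeg (overhead + factor)) (≤ᴿ-trans (≤ᴿ-reflexive expand)
          (+ᴿ-mono-≤ (≤-respˡ-≈ (+ᴿ-identityʳ _) (+ᴿ-mono-≤ (*ᴿ-monoˡ-≤ (fromℕ-nonNeg n) l≤log) (fromℕ-nonNeg e))) ≤ᴿ-refl))))
      where
      distribute : overhead + factor * (n * l) ≤ (overhead + factor) * (n * l + 1)
      distribute = ≤-trans
        (+-mono-≤ (≤-trans (≤-reflexive (sym (*-identityʳ overhead))) (*-monoʳ-≤ overhead (m≤n+m 1 (n * l))))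
          (*-monoʳ-≤ factor (m≤m+n (n * l) 1)))
        (≤-reflexive (sym (*-distribʳ-+ (n * l + 1) overhead factor)))

      expand : fromℕ (n * l + 1) ≈ fromℕ n *ᴿ fromℕ l +ᴿ 1#
      expand = ≈-trans (·-homo-+ 1# (n * l) 1) (+-cong (·1-homo-* n l) (+ᴿ-identityʳ 1#))

      l≤log : fromℕ l ≤ᴿ log₂ n
      l≤log = ≤ᴿ-trans (log₂-≥ n l 0 (≤-trans 2^l≤n (≤-reflexive (sym (*-identityʳ n)))))
        (≤ᴿ-reflexive (≈-trans (*-congʳ (+ᴿ-identityʳ 1#)) (*ᴿ-identityˡ _)))

    Correct : ∀ {n} .{{_ : NonZero n}} → (Fin n → UnitDisk) → Memory → Set
    Correct {n} D m = Bipartite (intersectionGraph D [ output n m ])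
      × (∀ M → IsMBS (intersectionGraph D) M → fromℕ ∣ M ∣ / ratio n ≤ᴿ fromℕ ∣ output n m ∣)

    firstTwo-correct : ∀ {n} .{{_ : NonZero n}} (D : Fin n → UnitDisk) m → n ≤ 16 → FirstTwo m → Correct D m
    firstTwo-correct {n} D m n≤16 two = firstTwo-bipartite D m two , λ M _ → firstTwo-approximates n m two n≤16 M

    algorithm-correct : ∀ {n} .{{_ : NonZero n}} (D : Fin n → UnitDisk) m → 16 ≤ n →
      Solved n (X D) (Y D) m → Correct D m
    algorithm-correct {n} D m 16≤n solved = output-bipartite D m solved , λ M (bipartite , _) →
      -- `2 ^ 8` and `16 ^ 2` are the same number, so `16 ≤ n` yields `8 ≤ 2 log n`.
      approximates-log n (∣ M ∣) (∣ output n m ∣) (∣ output n m ∣) 8 0 (^-monoˡ-≤ 2 16≤n)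
        (card-bipartite D m solved M bipartite) (≤-reflexive (*-identityʳ _))

    Efficient : ℕ → ℕ → Set
    Efficient overhead factor = ∀ {n} .{{_ : NonZero n}} (D : Fin n → UnitDisk) →
      ∃ λ l → 2 ^ l ≤ n × Runs (overhead + factor * (n * l)) program (input D) (Correct D)

    program-runs : BigO algorithmBound linearithmic → ∃₂ Efficient
    program-runs (K , algorithm≤) = suc (costᵗ few + bound firstTwo) , K , λ {n} D → decide D (n ≤? 16)
      where
      few-time : ∀ a b e → suc (a + (b + 0)) ≤ suc (a + b) + e
      few-time a b e = s≤s (≤-trans (+-monoʳ-≤ a (≤-reflexive (+-identityʳ b))) (m≤m+n (a + b) e))

      many-time : ∀ a b {d e} → d ≤ e → suc (a + (0 + d)) ≤ suc (a + b) + e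
      many-time a b d≤e = s≤s (+-mono-≤ (m≤m+n a b) d≤e)

      module _ {n : ℕ} .{{_ : NonZero n}} (D : Fin n → UnitDisk) where

        blank : Blank n (X D) (Y D) (input D)
        blank = refl , (λ _ → refl) , (λ _ → refl) , refl , refl

        few-disks : n ≤ 16 → Runs (suc (costᵗ few + (bound firstTwo + 0))) program (input D) (Correct D)
        few-disks n≤16 = runs-weaken (λ m → firstTwo-correct D m n≤16)
          (runs-if {few} {c = bound firstTwo} {d = 0} {P = firstTwo} {P′ = algorithm} {Q = FirstTwo}
            (λ _ → runs FirstTwo firstTwo (input D) (refl , refl , λ _ → refl))
            (λ n≰16 → contradiction n≤16 n≰16))

        many-disks : 16 < n → ∀ l → n < 2 ^ suc l →
          Runs (suc (costᵗ few + (0 + algorithmBound n l))) program (input D) (Correct D)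
        many-disks 16<n l upper = runs-weaken (λ m → algorithm-correct D m (<⇒≤ 16<n))
          (runs-if {few} {c = 0} {d = algorithmBound n l} {P = firstTwo} {P′ = algorithm} {Q = Solved n (X D) (Y D)}
            (λ n≤16 → contradiction n≤16 (<⇒≱ 16<n))
            (λ _ → algorithm-runs n (X D) (Y D) l (input D) (<⇒≤ upper) blank))

        decide : Dec (n ≤ 16) → ∃ λ l → 2 ^ l ≤ n ×
          Runs (suc (costᵗ few + bound firstTwo) + K * (n * l)) program (input D) (Correct D)
        -- With `l = 0` the linearithmic term vanishes and the overhead pays for everything.
        decide (yes n≤16) = 0 , >-nonZero⁻¹ n ,
          runs-bound (few-time (costᵗ few) (bound firstTwo) _) (few-disks n≤16)
        decide (no n≰16) with ⌊log₂ n ⌋-exists (≤-trans (s≤s z≤n) (≰⇒> n≰16))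
        -- `BigO` asks for `1 ≤ l`; `l = 0` would force `n < 2`.
        ... | zero  , _ , n<2 = contradiction (≤-trans (≰⇒> n≰16) (<⇒≤ n<2)) λ { (s≤s (s≤s ())) }
        ... | l@(suc _) , lower , upper = l , lower ,
          runs-bound (many-time (costᵗ few) (bound firstTwo)
              (algorithm≤ n l (≤-trans (s≤s z≤n) (≰⇒> n≰16)) (s≤s z≤n)))
            (many-disks (≰⇒> n≰16) l upper)

theorem22 : (ℝ : Reals) →
    let open Reals ℝ
        open RealProperties ℝ using (log₂)
        open UnitDisks ℝ
        open RealRAM ℝ
    in ∃₂ λ (P : Program) (c : ℕ) →
         ∀ (n : ℕ) .{{_ : NonZero n}} (D : Fin n → UnitDisk) → Injective _≡_ _≈ᴰ_ D →
         let G = intersectionGraph D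
         in ∃₂ λ (m : Memory) (t : ℕ) →
              ⟨ P , input D ⟩⇓⟨ m , t ⟩
              × fromℕ t ≤ fromℕ c * (fromℕ n * log₂ n + fromℕ (∣E D ∣) + 1#)
              × Bipartite (G [ output n m ])
              × (∀ (M : Subset n) → IsMBS G M →
                   fromℕ ∣ M ∣ / max 1# ((1# + 1#) * log₂ n) ≤ fromℕ ∣ output n m ∣)
theorem22 ℝ = let overhead , factor , efficient = program-runs O-algorithm in
  program , overhead ℕ.+ factor , λ n D _ →
  let l , 2^l≤n , m , t , P⇓ , t≤ , bipartite , approximate = efficient D
  in m , t , P⇓ , time-bound overhead factor n l t (∣E D ∣) 2^l≤n t≤ , bipartite , approximate
  where
  open Algorithm.Approximation ℝ
  open UnitDisks ℝ using (∣E_∣)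
  open Algorithm.Main ℝ using (O-algorithm)
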